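{- Let $n,k$ be integers with $1\leq k\leq n-3$ and let $G\in\mathfrak{C}'_{n,k}$. Then for every $v\in V(G)$, $f_G(v)\geq \frac{(n-k)^2+n+k+2}{2}$, and equality holds if and only if $G\cong L_{n,n-k}$ and $v$ is the pendant vertex of $L_{n,n-k}$.
   Context: All graphs are simple, finite, undirected and connected. A connected subgraph of $G$ is a subgraph (nonempty vertex subset with a subset of edges among them) that is connected; distinct subgraphs are counted separately. $f_G(v)$ is the number of connected subgraphs of $G$ containing the vertex $v$. $\mathfrak{C}_{n,k}$ is the family of connected graphs on $n$ vertices with exactly $k$ cut vertices, and $\mathfrak{C}'_{n,k}$ is the set of graphs in $\mathfrak{C}_{n,k}$ that are not trees. $L_{n,n-k}$ is the graph obtained by identifying an end vertex of the path $P_{k+1}$ with a vertex of the cycle $C_{n-k}$; it has $n$ vertices, $k$ cut vertices and a unique pendant vertex. -}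

module Defs where

open import Data.Nat using (ℕ; zero; suc; _+_; _*_; _∸_; _^_; _≤_; _≡ᵇ_)
open import Data.Fin using (Fin; toℕ; inject₁; fromℕ)
open import Data.Bool using (Bool; true; false; T; _∧_; _∨_; not)
open import Data.Vec using (Vec; lookup)
open import Data.Product using (Σ; _×_; ∃)
open import Relation.Nullary using (¬_)
open import Relation.Binary.PropositionalEquality using (_≡_; _≢_)
open import Function.Bundles using (_↔_; Inverse)
open import Function.Definitions using (Injective)

Graph : ℕ → Set
Graph n = Fin n → Fin n → Bool

IsSimple : ∀ {n} → Graph n → Set
IsSimple {n} G = ((i j : Fin n) → G i j ≡ G j i) × ((i : Fin n) → ¬ T (G i i))

data Walk {n : ℕ} (R : Graph n) : Fin n → Fin n → Set where
  here : ∀ {u} → Walk R u u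
  step : ∀ {u w x} → T (R u w) → Walk R w x → Walk R u x

Connected : ∀ {n} → Graph n → Set
Connected {n} G = (u w : Fin n) → Walk G u w

_isDeleted_ : ∀ {n} → Fin n → Fin n → Bool
_isDeleted_ {n} a v = toℕ a ≡ᵇ toℕ v

delete : ∀ {n} → Graph n → Fin n → Graph n
delete G v a b = G a b ∧ not (a isDeleted v) ∧ not (b isDeleted v)

IsCutVertex : ∀ {n} → Graph n → Fin n → Set
IsCutVertex {n} G v =
  ¬ ((u w : Fin n) → u ≢ v → w ≢ v → Walk (delete G v) u w)

record CutVertex {n : ℕ} (G : Graph n) : Set where
  constructor cutV
  field
    vertex : Fin n
    .isCut : IsCutVertex G vertex

NumCutVertices : ∀ {n} → Graph n → ℕ → Set
NumCutVertices G k = Fin k ↔ CutVertex G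

HasCycle : ∀ {n} → Graph n → Set
HasCycle {n} G = Σ ℕ λ m → Σ (Fin (suc (suc (suc m))) → Fin n) λ c →
  Injective _≡_ _≡_ c ×
  ((i : Fin (suc (suc m))) → T (G (c (inject₁ i)) (c (Data.Fin.suc i)))) ×
  T (G (c (fromℕ (suc (suc m)))) (c Data.Fin.zero))

IsTree : ∀ {n} → Graph n → Set
IsTree G = Connected G × ¬ HasCycle G

-- Connected subgraphs of G containing v: a vertex subset S (containing v,
-- hence nonempty) together with a subset E of the edges of G with both
-- ends in S (as a symmetric Boolean matrix), such that (S, E) is connected.
record ConnSub {n : ℕ} (G : Graph n) (v : Fin n) : Set where
  constructor connSub
  field
    S : Vec Bool n
    E : Vec (Vec Bool n) n
    .vIn : T (lookup S v)
    .Esub : (i j : Fin n) → T (lookup (lookup E i) j) →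
            T (G i j ∧ lookup S i ∧ lookup S j)
    .Esym : (i j : Fin n) → lookup (lookup E i) j ≡ lookup (lookup E j) i
    .conn : (u w : Fin n) → T (lookup S u) → T (lookup S w) →
            Walk (λ i j → lookup (lookup E i) j) u w

fCount : ∀ {n} → Graph n → Fin n → ℕ → Set
fCount G v N = Fin N ↔ ConnSub G v

Iso : ∀ {n} → Graph n → Graph n → (Fin n ↔ Fin n) → Set
Iso {n} G H σ = (i j : Fin n) → G i j ≡ H (Inverse.to σ i) (Inverse.to σ j)

-- L_{n,c} (c = n - k): vertices 0,…,n-1; the path 0 - 1 - … - (n-1)
-- together with the edge {0, c-1}.  Vertices 0..c-1 form the cycle C_c,
-- the path c-1, c, …, n-1 is P_{k+1}; the pendant vertex is n-1.
lEdge : ℕ → ℕ → ℕ → Bool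
lEdge c a b = (suc a ≡ᵇ b) ∨ ((a ≡ᵇ 0) ∧ (b ≡ᵇ c ∸ 1))

L : (n c : ℕ) → Graph n
L n c i j = not (toℕ i ≡ᵇ toℕ j) ∧ (lEdge c (toℕ i) (toℕ j) ∨ lEdge c (toℕ j) (toℕ i))

{-# OPTIONS --safe #-}
module Submission where

-- Let c = n − k be the number of non-cut vertices. Every subgraph R of G yields a connected subgraph, the component of v in R.
-- Each connected subgraph is counted twice, with a flag, so that unordered pairs become ordered ones. If x and y are vertices
-- other than v with x = y or both non-cut, then the component of v in G − x − y is an induced subgraph with boundary exactly
-- {x, y}, so distinct pairs give distinct subgraphs. Further subgraphs are G itself, G − e for a non-bridge e, and G − x − e for
-- a pendant x ≠ v. A non-cut vertex that is not pendant has at least two non-bridge edges, and so has some cut vertex r, because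
-- G has a cycle and a cut vertex. Adding up gives the bound; it is strict unless v is the only pendant vertex, and then equality
-- means that no other connected subgraph contains v.
-- In that case, growing a connected set from v by boundary vertices always meets a boundary that is a single vertex or two non-cut
-- vertices, and this forces a path from v into a cycle. Conversely, a connected subgraph of L n c containing the pendant vertex is
-- determined by how far it reaches along the path 0, …, n−1 from above and, through the edge {0, c−1}, from below.

open import Defs
open import Data.Bool using (Bool; true; false; T; _∧_; _∨_; not; if_then_else_)
import Data.Bool.Properties as Boolₚ
open import Data.Empty using (⊥; ⊥-elim)
open import Data.Fin using (Fin; toℕ; inject₁; fromℕ; zero; suc)
import Data.Fin as Fin
import Data.Fin.Properties as Finₚ
open import Data.List using (List; []; _∷_; _++_; length; lookup; map; filter; allFin; cartesianProduct; upTo)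
import Data.List.Membership.DecPropositional as DecMem
open import Data.List.Membership.Propositional using (_∈_; _∉_)
open import Data.List.Membership.Propositional.Properties using (∈-lookup; ∈-map⁻; ∈-map⁺; ∈-filter⁺; ∈-filter⁻; ∈-allFin; ∈-upTo⁺; ∈-++⁺ˡ; ∈-++⁺ʳ; ∈-++⁻; ∈-cartesianProduct⁺; ∈-cartesianProduct⁻)
import Data.List.Properties as Listₚ
open import Data.List.Relation.Unary.All using (All; []; _∷_)
import Data.List.Relation.Unary.All as All
open import Data.List.Relation.Unary.AllPairs using ([]; _∷_)
open import Data.List.Relation.Unary.Any using (here; there; index)
open import Data.List.Relation.Unary.Any.Properties using (lookup-index)
open import Data.List.Relation.Unary.Unique.Propositional using (Unique)
import Data.List.Relation.Unary.Unique.Propositional.Properties as Uniqueₚ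
open import Data.Nat using (ℕ; zero; suc; _+_; _*_; _∸_; _^_; _≤_; _<_; z≤n; s≤s; _≡ᵇ_; >-nonZero)
import Data.Nat.Properties as ℕₚ
open import Data.Nat.Solver using (module +-*-Solver)
open import Data.Product using (Σ; Σ-syntax; _×_; _,_; proj₁; proj₂)
import Data.Product.Properties as ×ₚ
open import Data.Sum using (_⊎_; inj₁; inj₂; [_,_]′)
open import Data.Unit using (tt)
open import Data.Vec using (Vec)
import Data.Vec as Vec
import Data.Vec.Properties as Vecₚ
open import Function using (_∘_; id; case_of_)
open import Function.Bundles using (_↔_; Inverse; _⇔_; mk↔ₛ′; mk⇔)
open import Relation.Binary.Definitions using (tri<; tri≈; tri>)
open import Relation.Binary.PropositionalEquality using (_≡_; _≢_; refl; sym; trans; cong; cong₂; subst; subst₂)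
open import Relation.Nullary using (¬_; Dec; yes; no)
open import Relation.Nullary.Decidable using (map′; _⊎-dec_; _×-dec_; _→-dec_; ¬?; isYes; toWitness; fromWitness; recompute; decidable-stable)
open +-*-Solver using (solve; con; _:+_; _:*_; _:=_)

-- The doubling serves the edges too: a non-bridge may be listed from each of its ends, so two
-- non-bridges at each of m vertices are worth m subgraphs. If `v` is the only pendant vertex, the
-- bound calls for exactly c such vertices. But `v` lies on no non-bridge, so the non-cut vertices
-- supply only c - 1 of them, and this is why `r` has to be a cut vertex. A further pendant vertex
-- loses two edge entries and gains four entries G - x - e, hence the strictness. For `L n c` an
-- upper bound on the number of subgraphs is enough, as the lower bound holds for every graph; the
-- same upper bound later fixes the length of the cycle found in the equality case.

T⇔→≡ : ∀ {a b} → (T a → T b) → (T b → T a) → a ≡ b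
T⇔→≡ {false} {false} _ _ = refl
T⇔→≡ {false} {true}  _ g = ⊥-elim (g tt)
T⇔→≡ {true}  {false} f _ = ⊥-elim (f tt)
T⇔→≡ {true}  {true}  _ _ = refl

T-∧⁺ : ∀ {a b} → T a → T b → T (a ∧ b)
T-∧⁺ {true} _ q = q

T-∧⁻ : ∀ {a b} → T (a ∧ b) → T a × T b
T-∧⁻ {true} q = tt , q

T-not : ∀ {b} → ¬ T b → T (not b)
T-not {false} _ = tt
T-not {true}  f = f tt

not-T : ∀ {b} → T (not b) → ¬ T b
not-T {false} _ ()

T-∨⁻ : ∀ {a b} → T (a ∨ b) → T a ⊎ T b
T-∨⁻ {true}  _ = inj₁ tt
T-∨⁻ {false} q = inj₂ q

T-∨⁺ : ∀ {a b} → T a ⊎ T b → T (a ∨ b)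
T-∨⁺ {true}  _        = tt
T-∨⁺ {false} (inj₂ q) = q

T-subst : ∀ {a b} → a ≡ b → T a → T b
T-subst refl p = p

-- Counting with duplicate-free lists

module _ {A : Set} where

  lookup-injective : ∀ {xs : List A} → Unique xs → ∀ {i j} → lookup xs i ≡ lookup xs j → i ≡ j
  lookup-injective (_ ∷ _)  {zero}  {zero}  _  = refl
  lookup-injective (p ∷ _)  {zero}  {suc j} eq = ⊥-elim (All.lookup p (∈-lookup j) eq)
  lookup-injective (p ∷ _)  {suc i} {zero}  eq = ⊥-elim (All.lookup p (∈-lookup i) (sym eq))
  lookup-injective (_ ∷ us) {suc i} {suc j} eq = cong suc (lookup-injective us eq)

  unique-⊆⇒length≤ : ∀ {xs ys : List A} → Unique xs → (∀ {x} → x ∈ xs → x ∈ ys) → length xs ≤ length ys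
  unique-⊆⇒length≤ {xs} {ys} u sub = Finₚ.injective⇒≤ {f = λ i → index (sub (∈-lookup i))} λ {i} {j} eq →
    lookup-injective u
      (trans (lookup-index (sub (∈-lookup i)))
        (trans (cong (lookup ys) eq) (sym (lookup-index (sub (∈-lookup j))))))

  unique-∷ : ∀ {x} {xs : List A} → x ∉ xs → Unique xs → Unique (x ∷ xs)
  unique-∷ x∉ u = All.tabulate (λ {y} y∈ eq → x∉ (subst (_∈ _) (sym eq) y∈)) ∷ u

  unique-head∉ : ∀ {x} {xs : List A} → Unique (x ∷ xs) → x ∉ xs
  unique-head∉ (p ∷ _) x∈ = All.lookup p x∈ refl

unique-map : ∀ {A B : Set} {f : A → B} {xs} →
  (∀ {x y} → x ∈ xs → y ∈ xs → f x ≡ f y → x ≡ y) → Unique xs → Unique (map f xs)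
unique-map inj [] = []
unique-map {f = f} inj (p ∷ u) =
  unique-∷ (λ fx∈ → let (y , y∈ , eq) = ∈-map⁻ f fx∈ in All.lookup p y∈ (inj (here refl) (there y∈) eq))
           (unique-map (λ x∈ y∈ → inj (there x∈) (there y∈)) u)

module _ {A : Set} where

  unique-++ : ∀ {P : A → Set} {xs ys} → Unique xs → Unique ys →
    (∀ {x} → x ∈ xs → P x) → (∀ {x} → x ∈ ys → ¬ P x) → Unique (xs ++ ys)
  unique-++ u w p q = Uniqueₚ.++⁺ u w (λ (x∈ , y∈) → q y∈ (p x∈))

  length-filter-¬ : ∀ {P : A → Set} (P? : ∀ x → Dec (P x)) (xs : List A) →
    length (filter P? xs) + length (filter (¬? ∘ P?) xs) ≡ length xs
  length-filter-¬ P? [] = refl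
  length-filter-¬ P? (x ∷ xs) with P? x
  ... | yes p = cong suc (length-filter-¬ P? xs)
  ... | no ¬p = trans (ℕₚ.+-suc _ _) (cong suc (length-filter-¬ P? xs))

  module _ (_≟_ : (x y : A) → Dec (x ≡ y)) where

    length-without-∉ : ∀ {x} {xs : List A} → x ∉ xs → length (filter (λ y → ¬? (y ≟ x)) xs) ≡ length xs
    length-without-∉ x∉ = cong length (Listₚ.filter-all _ (All.tabulate λ y∈ eq → x∉ (subst (_∈ _) eq y∈)))

    length-without-∈ : ∀ {x} {xs : List A} → Unique xs → x ∈ xs → suc (length (filter (λ y → ¬? (y ≟ x)) xs)) ≡ length xs
    length-without-∈ {x} {xs} u x∈ = trans (cong (_+ length (filter (λ y → ¬? (y ≟ x)) xs)) (sym one)) (length-filter-¬ (_≟ x) xs)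
      where
      one : length (filter (_≟ x) xs) ≡ 1
      one = ℕₚ.≤-antisym
        (unique-⊆⇒length≤ {ys = x ∷ []} (Uniqueₚ.filter⁺ (_≟ x) u)
          (λ {y} y∈ → here (proj₂ (∈-filter⁻ (_≟ x) {xs = xs} y∈))))
        (unique-⊆⇒length≤ {xs = x ∷ []} ([] ∷ []) λ { (here refl) → ∈-filter⁺ (_≟ x) x∈ refl })

    -- Pigeonhole: a missing `x` could be put in front of `xs`, giving a duplicate-free list longer
    -- than the complete list `ys`.
    unique-exhaustive : ∀ {xs ys : List A} → Unique xs → (∀ {x} → x ∈ ys) → length ys ≤ length xs → ∀ x → x ∈ xs
    unique-exhaustive {xs} {ys} u all len x with DecMem._∈?_ _≟_ x xs
    ... | yes x∈ = x∈
    ... | no x∉ = ⊥-elim (ℕₚ.<-irrefl refl (ℕₚ.≤-trans (unique-⊆⇒length≤ {ys = ys} (unique-∷ x∉ u) (λ _ → all)) len))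

length-cartesianProduct : ∀ {A B : Set} (xs : List A) (ys : List B) → length (cartesianProduct xs ys) ≡ length xs * length ys
length-cartesianProduct []       ys = refl
length-cartesianProduct (x ∷ xs) ys = trans (Listₚ.length-++ (map (x ,_) ys)) (cong₂ _+_ (Listₚ.length-map (x ,_) ys) (length-cartesianProduct xs ys))

length-allFin : ∀ n → length (allFin n) ≡ n
length-allFin n = Listₚ.length-tabulate id

-- Walks

module _ {n : ℕ} where

  infixr 5 _++ʷ_

  _++ʷ_ : ∀ {R : Graph n} {u w x} → Walk R u w → Walk R w x → Walk R u x
  here     ++ʷ q = q
  step e p ++ʷ q = step e (p ++ʷ q)

  edgeʷ : ∀ {R : Graph n} {u w} → T (R u w) → Walk R u w
  edgeʷ e = step e here

  bindʷ : ∀ {R R′ : Graph n} → (∀ {a b} → T (R a b) → Walk R′ a b) → ∀ {u w} → Walk R u w → Walk R′ u w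
  bindʷ f here       = here
  bindʷ f (step e p) = f e ++ʷ bindʷ f p

  mapʷ : ∀ {R R′ : Graph n} → (∀ {a b} → T (R a b) → T (R′ a b)) → ∀ {u w} → Walk R u w → Walk R′ u w
  mapʷ f = bindʷ (edgeʷ ∘ f)

  Symmetric : Graph n → Set
  Symmetric R = ∀ i j → R i j ≡ R j i

  swap : ∀ {R : Graph n} → Symmetric R → ∀ {i j} → T (R i j) → T (R j i)
  swap s {i} {j} = T-subst (s i j)

  revʷ : ∀ {R : Graph n} → Symmetric R → ∀ {u w} → Walk R u w → Walk R w u
  revʷ s here       = here
  revʷ s (step e p) = revʷ s p ++ʷ edgeʷ (swap s e)

  exit : ∀ {R : Graph n} {P : Fin n → Set} (P? : ∀ z → Dec (P z)) → ∀ {u w} → Walk R u w → P u → ¬ P w →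
    Σ[ s ∈ Fin n ] Σ[ t ∈ Fin n ] (P s × ¬ P t × T (R s t))
  exit P? here pu ¬pw = ⊥-elim (¬pw pu)
  exit P? (step {u} {x} e p) pu ¬pw with P? x
  ... | yes px = exit P? p px ¬pw
  ... | no ¬px = u , x , pu , ¬px , e

  module _ (R : Graph n) where

    -- Warshall's scheme: walks whose inner vertices lie in the given list.
    Reach : List (Fin n) → Fin n → Fin n → Set
    Reach []       u w = u ≡ w ⊎ T (R u w)
    Reach (x ∷ xs) u w = Reach xs u w ⊎ (Reach xs u x × Reach xs x w)

    reach? : ∀ xs u w → Dec (Reach xs u w)
    reach? []       u w = (u Finₚ.≟ w) ⊎-dec Boolₚ.T? (R u w)
    reach? (x ∷ xs) u w = reach? xs u w ⊎-dec (reach? xs u x ×-dec reach? xs x w)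

    reach-walk : ∀ xs {u w} → Reach xs u w → Walk R u w
    reach-walk []       (inj₁ refl)    = here
    reach-walk []       (inj₂ e)       = edgeʷ e
    reach-walk (x ∷ xs) (inj₁ r)       = reach-walk xs r
    reach-walk (x ∷ xs) (inj₂ (r , s)) = reach-walk xs r ++ʷ reach-walk xs s

    -- If `x` is the head, a walk to `x` can be stopped at its first visit there and a walk from `x`
    -- can be started at its last one, so neither needs `x` as an inner vertex.
    reach-trans : ∀ {xs x u w} → x ∈ xs → Reach xs u x → Reach xs x w → Reach xs u w
    reach-trans {xs = y ∷ ys} {u = u} {w} (here refl) r s = inj₂ (toʸ r , fromʸ s)
      where
      toʸ : Reach (y ∷ ys) u y → Reach ys u y
      toʸ (inj₁ p)       = p
      toʸ (inj₂ (p , _)) = p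
      fromʸ : Reach (y ∷ ys) y w → Reach ys y w
      fromʸ (inj₁ p)       = p
      fromʸ (inj₂ (_ , p)) = p
    reach-trans (there x∈) (inj₁ r)       (inj₁ s)        = inj₁ (reach-trans x∈ r s)
    reach-trans (there x∈) (inj₁ r)       (inj₂ (s , s′)) = inj₂ (reach-trans x∈ r s , s′)
    reach-trans (there x∈) (inj₂ (r , r′)) (inj₁ s)       = inj₂ (r , reach-trans x∈ r′ s)
    -- Both walks pass through the head of the list; everything between these two visits, `x`
    -- included, is cut out.
    reach-trans (there x∈) (inj₂ (r , _)) (inj₂ (_ , s′)) = inj₂ (r , s′)

    reach-base : ∀ xs {u w} → Reach [] u w → Reach xs u w
    reach-base []       r = r
    reach-base (x ∷ xs) r = inj₁ (reach-base xs r)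

    walk-reach : ∀ {u w} → Walk R u w → Reach (allFin n) u w
    walk-reach here       = reach-base (allFin n) (inj₁ refl)
    walk-reach (step e p) = reach-trans (∈-allFin _) (reach-base (allFin n) (inj₂ e)) (walk-reach p)

    abstract
      walk? : ∀ u w → Dec (Walk R u w)
      walk? u w = map′ (reach-walk (allFin n)) walk-reach (reach? (allFin n) u w)

    connected? : Dec (Connected R)
    connected? = Finₚ.all? λ u → Finₚ.all? λ w → walk? u w

  isDeleted⇒≡ : ∀ {a v : Fin n} → T (a isDeleted v) → a ≡ v
  isDeleted⇒≡ {a} {v} p = Finₚ.toℕ-injective (ℕₚ.≡ᵇ⇒≡ (toℕ a) (toℕ v) p)

  delete⁺ : ∀ {R : Graph n} {x a b} → T (R a b) → a ≢ x → b ≢ x → T (delete R x a b)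
  delete⁺ e p q = T-∧⁺ e (T-∧⁺ (T-not (p ∘ isDeleted⇒≡)) (T-not (q ∘ isDeleted⇒≡)))

  delete⁻ : ∀ {R : Graph n} {x a b} → T (delete R x a b) → T (R a b) × a ≢ x × b ≢ x
  delete⁻ {R} {x} {a} {b} t =
    let (e , pq) = T-∧⁻ {R a b} t ; (p , q) = T-∧⁻ {not (a isDeleted x)} pq in
    e , (λ { refl → not-T p (ℕₚ.≡⇒≡ᵇ (toℕ x) (toℕ x) refl) }) , (λ { refl → not-T q (ℕₚ.≡⇒≡ᵇ (toℕ x) (toℕ x) refl) })

  delete-sym : ∀ {R : Graph n} → Symmetric R → ∀ x → Symmetric (delete R x)
  delete-sym {R} s x i j = T⇔→≡ (flip′ i j) (flip′ j i)
    where
    flip′ : ∀ i j → T (delete R x i j) → T (delete R x j i)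
    flip′ i j t = let (e , p , q) = delete⁻ {R} t in delete⁺ {R} (swap s e) q p

  DeletedEdge : Graph n → Fin n → Fin n → Fin n → Fin n → Set
  DeletedEdge R x y a b = T (R a b) × ¬ ((a ≡ x × b ≡ y) ⊎ (a ≡ y × b ≡ x))

  deletedEdge? : ∀ R x y a b → Dec (DeletedEdge R x y a b)
  deletedEdge? R x y a b = Boolₚ.T? (R a b) ×-dec ¬? (((a Finₚ.≟ x) ×-dec (b Finₚ.≟ y)) ⊎-dec ((a Finₚ.≟ y) ×-dec (b Finₚ.≟ x)))

  deleteEdge : Graph n → Fin n → Fin n → Graph n
  deleteEdge R x y a b = isYes (deletedEdge? R x y a b)

  deleteEdge⁺ : ∀ {R : Graph n} {x y a b} → DeletedEdge R x y a b → T (deleteEdge R x y a b)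
  deleteEdge⁺ {R} {x} {y} {a} {b} = fromWitness {a? = deletedEdge? R x y a b}

  deleteEdge⁻ : ∀ {R : Graph n} {x y a b} → T (deleteEdge R x y a b) → DeletedEdge R x y a b
  deleteEdge⁻ {R} {x} {y} {a} {b} = toWitness {a? = deletedEdge? R x y a b}

  deleteEdge-sym : ∀ {R : Graph n} → Symmetric R → ∀ x y → Symmetric (deleteEdge R x y)
  deleteEdge-sym {R} s x y i j = T⇔→≡ (flip′ i j) (flip′ j i)
    where
    flip′ : ∀ i j → T (deleteEdge R x y i j) → T (deleteEdge R x y j i)
    flip′ i j t = let (e , p) = deleteEdge⁻ {R} t in
      deleteEdge⁺ {R} (swap s e , λ { (inj₁ (a , b)) → p (inj₂ (b , a)) ; (inj₂ (a , b)) → p (inj₁ (b , a)) })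

  deleteEdge-flip : ∀ {R : Graph n} {x y a b} → T (deleteEdge R x y a b) → T (deleteEdge R y x a b)
  deleteEdge-flip {R} t = let (e , p) = deleteEdge⁻ {R} t in deleteEdge⁺ {R} (e , p ∘ [ inj₂ , inj₁ ]′)

  -- The walk is cut at its last visit to `u`, if there is one; what follows avoids `u`.
  leave : ∀ {R : Graph n} {u a z} → z ≢ u → Walk R a z →
    (a ≢ u × Walk (delete R u) a z) ⊎ (Σ[ w ∈ Fin n ] (T (R u w) × w ≢ u × Walk (delete R u) w z))
  leave z≢u here = inj₁ (z≢u , here)
  leave {R} {u} z≢u (step {a} e p) with leave {R} {u} z≢u p | a Finₚ.≟ u
  ... | inj₂ r         | _        = inj₂ r
  ... | inj₁ (w≢u , q) | yes refl = inj₂ (_ , e , w≢u , q)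
  ... | inj₁ (w≢u , q) | no a≢u   = inj₁ (a≢u , step (delete⁺ {R} e a≢u w≢u) q)

  Pendant : Graph n → Fin n → Set
  Pendant R x = ∀ y z → T (R x y) → T (R x z) → y ≡ z

  abstract
    pendant? : ∀ R x → Dec (Pendant R x)
    pendant? R x = Finₚ.all? λ y → Finₚ.all? λ z → Boolₚ.T? (R x y) →-dec (Boolₚ.T? (R x z) →-dec (y Finₚ.≟ z))

  delete-pendant : ∀ {R : Graph n} → Symmetric R → ∀ {x} → Pendant R x → ∀ {u w} → u ≢ x → w ≢ x →
    Walk R u w → Walk (delete R x) u w
  delete-pendant s pend u≢x w≢x here = here
  delete-pendant {R} s {x} pend u≢x w≢x (step {u} {a} e p) with a Finₚ.≟ x
  ... | no a≢x = step (delete⁺ {R} e u≢x a≢x) (delete-pendant s pend a≢x w≢x p)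
  delete-pendant s pend u≢x w≢x (step e here) | yes refl = ⊥-elim (w≢x refl)
  delete-pendant s pend u≢x w≢x (step {u} e (step f p)) | yes refl
    with refl ← pend _ _ f (swap s e) = delete-pendant s pend u≢x w≢x p

  NonBridge : Graph n → Fin n → Fin n → Set
  NonBridge R x y = T (R x y) × Connected (deleteEdge R x y)

  nonBridge? : ∀ R x y → Dec (NonBridge R x y)
  nonBridge? R x y = Boolₚ.T? (R x y) ×-dec connected? (deleteEdge R x y)

  nonBridge-sym : ∀ {R : Graph n} → Symmetric R → ∀ {x y} → NonBridge R x y → NonBridge R y x
  nonBridge-sym {R} s (e , c) = swap s e , λ u w → mapʷ (deleteEdge-flip {R}) (c u w)

  -- Each use of the edge in a walk is replaced by the detour, reversed where the edge is traversed
  -- from `y` to `x`.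
  detour : ∀ {R : Graph n} → Symmetric R → Connected R → ∀ {x y} → T (R x y) → Walk (deleteEdge R x y) x y → NonBridge R x y
  detour {R} s conn {x} {y} e p = e , λ u w → bindʷ f (conn u w)
    where
    f : ∀ {a b} → T (R a b) → Walk (deleteEdge R x y) a b
    f {a} {b} t with ((a Finₚ.≟ x) ×-dec (b Finₚ.≟ y)) ⊎-dec ((a Finₚ.≟ y) ×-dec (b Finₚ.≟ x))
    ... | yes (inj₁ (refl , refl)) = p
    ... | yes (inj₂ (refl , refl)) = revʷ (deleteEdge-sym s x y) p
    ... | no q = edgeʷ (deleteEdge⁺ {R} (t , q))

  -- The edge from `x` to `z` and the walk from `z` to `y` outside `x` close a cycle through the
  -- edge `x y`.
  detour-via : ∀ {R : Graph n} → Symmetric R → Connected R → ∀ {x y z} → T (R x y) → T (R x z) → y ≢ x → y ≢ z →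
    Walk (delete R x) z y → NonBridge R x y
  detour-via {R} s conn {x} {y} {z} e f y≢x y≢z p = detour s conn e
    (step (deleteEdge⁺ {R} (f , λ { (inj₁ (_ , eq)) → y≢z (sym eq) ; (inj₂ (eq , _)) → y≢x (sym eq) })) (mapʷ g p))
    where
    g : ∀ {a b} → T (delete R x a b) → T (deleteEdge R x y a b)
    g t = let (e′ , a≢x , b≢x) = delete⁻ {R} t in
      deleteEdge⁺ {R} (e′ , λ { (inj₁ (eq , _)) → a≢x eq ; (inj₂ (_ , eq)) → b≢x eq })

  -- In a connected graph this means lying on a cycle. The form with two non-bridges is the one
  -- needed for counting edges by their ends.
  Good : Graph n → Fin n → Set
  Good R x = Σ[ y ∈ Fin n ] Σ[ z ∈ Fin n ] (y ≢ z × NonBridge R x y × NonBridge R x z)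

  abstract
    good? : ∀ R x → Dec (Good R x)
    good? R x = Finₚ.any? λ y → Finₚ.any? λ z → ¬? (y Finₚ.≟ z) ×-dec (nonBridge? R x y ×-dec nonBridge? R x z)

  NonCut : Graph n → Fin n → Set
  NonCut R x = ∀ u w → u ≢ x → w ≢ x → Walk (delete R x) u w

  abstract
    nonCut? : ∀ R x → Dec (NonCut R x)
    nonCut? R x = Finₚ.all? λ u → Finₚ.all? λ w → ¬? (u Finₚ.≟ x) →-dec (¬? (w Finₚ.≟ x) →-dec walk? (delete R x) u w)

  pendant⇒nonCut : ∀ {R : Graph n} → Symmetric R → Connected R → ∀ {x} → Pendant R x → NonCut R x
  pendant⇒nonCut s conn pend u w u≢x w≢x = delete-pendant s pend u≢x w≢x (conn u w)

  module _ {R : Graph n} (s : Symmetric R) (irr : ∀ i → ¬ T (R i i)) (conn : Connected R) where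

    edge≢ : ∀ {x y} → T (R x y) → y ≢ x
    edge≢ e refl = irr _ e

    -- A walk from `x` to `y` around the deleted edge leaves `x` for the last time by another edge
    -- `x w`. Its remainder, reversed, leads from `y` to `w` outside `x` and so makes `x w` a
    -- non-bridge.
    nonBridge⇒good : ∀ {x y} → NonBridge R x y → Good R x
    nonBridge⇒good {x} {y} nb@(e , c) with leave (edge≢ e) (c x y)
    ... | inj₁ (x≢x , _) = ⊥-elim (x≢x refl)
    ... | inj₂ (w , f , w≢x , p) = y , w , y≢w , nb , detour-via s conn f′ e w≢x (y≢w ∘ sym) (revʷ (delete-sym s x) (mapʷ g p))
      where
      f′ = proj₁ (deleteEdge⁻ {R} f)
      y≢w : y ≢ w
      y≢w eq = proj₂ (deleteEdge⁻ {R} f) (inj₁ (refl , sym eq))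
      g : ∀ {a b} → T (delete (deleteEdge R x y) x a b) → T (delete R x a b)
      g t = let (e , p , q) = delete⁻ {deleteEdge R x y} t in delete⁺ {R} (proj₁ (deleteEdge⁻ {R} e)) p q

    -- A second neighbour `z` of `x` exists, and it is joined to `y` after deleting the non-cut
    -- vertex `x`.
    nonCut-nonBridge : ∀ {x} → NonCut R x → ¬ Pendant R x → ∀ {y} → T (R x y) → NonBridge R x y
    nonCut-nonBridge {x} nc ¬pend {y} e with Finₚ.any? (λ z → Boolₚ.T? (R x z) ×-dec ¬? (y Finₚ.≟ z))
    ... | yes (z , f , y≢z) = detour-via s conn e f (edge≢ e) y≢z (nc z y (edge≢ f) (edge≢ e))
    ... | no ¬z = ⊥-elim (¬pend λ a b p q → trans (sym (is-y p)) (is-y q))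
      where
      is-y : ∀ {a} → T (R x a) → y ≡ a
      is-y {a} p = decidable-stable (y Finₚ.≟ a) λ y≢a → ¬z (a , p , y≢a)

    good⇒¬pendant : ∀ {x} → Good R x → ¬ Pendant R x
    good⇒¬pendant (y , z , y≢z , (e , _) , (f , _)) pend = y≢z (pend y z e f)

    good-nonCut-spreads : ∀ {x} → NonCut R x → Good R x → ∀ {y} → T (R x y) → Good R y
    good-nonCut-spreads nc g e = nonBridge⇒good (nonBridge-sym s (nonCut-nonBridge nc (good⇒¬pendant g) e))

    -- Source of the vertex `r`: if no good vertex were a cut vertex, goodness would spread along
    -- every edge of the connected graph, and no cut vertex would remain.
    all-good : ∀ {x} → (∀ z → Good R z → NonCut R z) → Good R x → ∀ z → Good R z
    all-good h g z = go g (conn _ z)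
      where
      go : ∀ {a} → Good R a → Walk R a z → Good R z
      go g here       = g
      go g (step e p) = go (good-nonCut-spreads (h _ g) g e) p

    cycle⇒nonBridge : HasCycle R → Σ[ x ∈ Fin n ] Σ[ y ∈ Fin n ] NonBridge R x y
    cycle⇒nonBridge (m , c , inj , es , close) = c (fromℕ (suc (suc m))) , c zero , nonBridge-sym s (detour s conn (swap s close) (steps _ (fromℕ (suc (suc m))) refl))
      where
      R′ = deleteEdge R (c zero) (c (fromℕ (suc (suc m))))
      edge′ : ∀ i → T (R′ (c (inject₁ i)) (c (suc i)))
      edge′ i = deleteEdge⁺ {R} (es i , λ
        { (inj₁ (p , q)) → first-last i (inj p) (inj q)
        ; (inj₂ (_ , q)) → case inj q of λ () })
        where
        -- A cycle has at least three vertices, so its first and last vertices are not consecutive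
        -- on the path and no path edge is the closing edge.
        first-last : ∀ {m} (i : Fin (suc (suc m))) → inject₁ i ≡ zero → Fin.suc i ≡ fromℕ (suc (suc m)) → ⊥
        first-last zero _ ()
        first-last (suc i) () _
      steps : ∀ k (i : Fin (suc (suc (suc m)))) → toℕ i ≡ k → Walk R′ (c zero) (c i)
      steps k       zero    _  = here
      steps (suc k) (suc i) eq = steps k (inject₁ i) (trans (Finₚ.toℕ-inject₁ i) (ℕₚ.suc-injective eq)) ++ʷ edgeʷ (edge′ i)

-- Components of `v` in subgraphs of G, and the invariants that distinguish them

module ComponentCount {n : ℕ} (G : Graph n) (sG : Symmetric G) (irr : ∀ i → ¬ T (G i i)) (conn : Connected G) (v : Fin n) where

  -- A subgraph is given by its edges alone and keeps all vertices; deleting a vertex means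
  -- isolating it, because only the component of `v` is read off.
  record Sub : Set where
    constructor sub
    field
      graph : Graph n
      symm  : Symmetric graph
      below : ∀ {i j} → T (graph i j) → T (G i j)

  open Sub

  In : Sub → Fin n → Set
  In A = Walk (graph A) v

  in? : ∀ A z → Dec (In A z)
  in? A = walk? (graph A) v

  inᵇ : Sub → Fin n → Bool
  inᵇ A z = isYes (in? A z)

  in⁺ : ∀ A {z} → In A z → T (inᵇ A z)
  in⁺ A {z} = fromWitness {a? = in? A z}

  in⁻ : ∀ A {z} → T (inᵇ A z) → In A z
  in⁻ A {z} = toWitness {a? = in? A z}

  in-step : ∀ A {i j} → In A i → T (graph A i j) → In A j
  in-step A p e = p ++ʷ edgeʷ e

  abstract

    compS : Sub → Vec Bool n
    compS A = Vec.tabulate (inᵇ A)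

    compE : Sub → Vec (Vec Bool n) n
    compE A = Vec.tabulate λ i → Vec.tabulate λ j → graph A i j ∧ inᵇ A i ∧ inᵇ A j

    lookup-compS : ∀ A z → Vec.lookup (compS A) z ≡ inᵇ A z
    lookup-compS A = Vecₚ.lookup∘tabulate (inᵇ A)

    lookup-compE : ∀ A i j → Vec.lookup (Vec.lookup (compE A) i) j ≡ graph A i j ∧ inᵇ A i ∧ inᵇ A j
    lookup-compE A i j = trans (cong (λ r → Vec.lookup r j) (Vecₚ.lookup∘tabulate _ i)) (Vecₚ.lookup∘tabulate _ j)

    compE⁺ : ∀ A {i j} → In A i → T (graph A i j) → T (Vec.lookup (Vec.lookup (compE A) i) j)
    compE⁺ A {i} {j} p e = T-subst (sym (lookup-compE A i j)) (T-∧⁺ e (T-∧⁺ (in⁺ A p) (in⁺ A (in-step A p e))))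

    compE⁻ : ∀ A {i j} → T (Vec.lookup (Vec.lookup (compE A) i) j) → T (graph A i j) × T (inᵇ A i) × T (inᵇ A j)
    compE⁻ A {i} {j} t = let (e , pq) = T-∧⁻ {graph A i j} (T-subst (lookup-compE A i j) t) in e , T-∧⁻ {inᵇ A i} pq

    comp : Sub → ConnSub G v
    comp A = connSub (compS A) (compE A) (T-subst (sym (lookup-compS A v)) (in⁺ A here)) below′
      (λ i j → T⇔→≡ (flip′ i j) (flip′ j i))
      (λ u w p q → lift here (in⁻ A (T-subst (lookup-compS A u) p))
        (revʷ (symm A) (in⁻ A (T-subst (lookup-compS A u) p)) ++ʷ in⁻ A (T-subst (lookup-compS A w) q)))
      where
      below′ : ∀ i j → T (Vec.lookup (Vec.lookup (compE A) i) j) → T (G i j ∧ Vec.lookup (compS A) i ∧ Vec.lookup (compS A) j)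
      below′ i j t = let (e , p , q) = compE⁻ A t in
        T-∧⁺ (below A e) (T-∧⁺ (T-subst (sym (lookup-compS A i)) p) (T-subst (sym (lookup-compS A j)) q))
      flip′ : ∀ i j → T (Vec.lookup (Vec.lookup (compE A) i) j) → T (Vec.lookup (Vec.lookup (compE A) j) i)
      flip′ i j t = let (e , p , q) = compE⁻ A t in compE⁺ A (in⁻ A q) (swap (symm A) e)
      -- `acc` is the part of the walk already known to lie in the component. Membership of its end
      -- `a` lets the next edge be added.
      lift : ∀ {u a w} → Walk (λ i j → Vec.lookup (Vec.lookup (compE A) i) j) u a → In A a → Walk (graph A) a w →
        Walk (λ i j → Vec.lookup (Vec.lookup (compE A) i) j) u w
      lift acc pa here       = acc
      lift acc pa (step e p) = lift (acc ++ʷ edgeʷ (compE⁺ A pa e)) (in-step A pa e) p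

    comp-⊆ : ∀ {A B} → comp A ≡ comp B → ∀ {z} → In A z → In B z
    comp-⊆ {A} {B} eq {z} p = in⁻ B (T-subst (trans (sym (lookup-compS A z)) (trans (cong (λ c → Vec.lookup (ConnSub.S c) z) eq) (lookup-compS B z))) (in⁺ A p))

    comp-edge : ∀ {A B} → comp A ≡ comp B → ∀ {i j} → In A i → T (graph A i j) → T (graph B i j)
    comp-edge {A} {B} eq {i} {j} p e = proj₁ (compE⁻ B (T-subst (cong (λ c → Vec.lookup (Vec.lookup (ConnSub.E c) i) j) eq) (compE⁺ A p e)))

  whole : Sub
  whole = sub G sG id

  infixl 6 _-ᵛ_

  _-ᵛ_ : Sub → Fin n → Sub
  A -ᵛ x = sub (delete (graph A) x) (delete-sym (symm A) x) (below A ∘ proj₁ ∘ delete⁻ {R = graph A})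

  _-ᵉ_,_ : Sub → Fin n → Fin n → Sub
  A -ᵉ x , y = sub (deleteEdge (graph A) x y) (deleteEdge-sym (symm A) x y) (below A ∘ proj₁ ∘ deleteEdge⁻ {R = graph A})

  Full : Sub → Set
  Full A = ∀ z → In A z

  Induced : Sub → Set
  Induced A = ∀ {i j} → In A i → In A j → T (G i j) → T (graph A i j)

  Boundary : Sub → Fin n → Set
  Boundary A z = ¬ In A z × (Σ[ s ∈ Fin n ] (In A s × T (G s z)))

  -- Spanning G, being induced and the boundary depend only on the component. The first two tell the
  -- listed families apart; the boundary recovers the deleted pair.
  full-resp : ∀ {A B} → comp A ≡ comp B → Full A → Full B
  full-resp {A} {B} eq f z = comp-⊆ {A} {B} eq (f z)

  induced-resp : ∀ {A B} → comp A ≡ comp B → Induced A → Induced B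
  induced-resp {A} {B} eq f p q e = comp-edge {A} {B} eq (comp-⊆ {B} {A} (sym eq) p) (f (comp-⊆ {B} {A} (sym eq) p) (comp-⊆ {B} {A} (sym eq) q) e)

  boundary-resp : ∀ {A B} → comp A ≡ comp B → ∀ {z} → Boundary A z → Boundary B z
  boundary-resp {A} {B} eq (z∉ , s , p , e) = z∉ ∘ comp-⊆ {B} {A} (sym eq) , s , comp-⊆ {A} {B} eq p , e

  exit-in : ∀ A {R : Graph n} {z} → (∀ {i j} → T (R i j) → T (G i j)) → Walk R v z → ¬ In A z →
    Σ[ s ∈ Fin n ] Σ[ t ∈ Fin n ] (Boundary A t × T (R s t))
  exit-in A below′ p z∉ = let (s , t , s∈ , t∉ , e) = exit (in? A) p here z∉ in s , t , (t∉ , s , s∈ , below′ e) , e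

  in-delete≢ : ∀ A {x z} → v ≢ x → In (A -ᵛ x) z → z ≢ x
  in-delete≢ A {x} v≢x = go v≢x
    where
    go : ∀ {u z} → u ≢ x → Walk (delete (graph A) x) u z → z ≢ x
    go u≢x here       = u≢x
    go u≢x (step e p) = go (proj₂ (proj₂ (delete⁻ {R = graph A} e))) p

  -- The case `x ≡ y` gives G - x, so single vertices are the diagonal of the pairs.
  cutAt : Fin n → Fin n → Sub
  cutAt x y = whole -ᵛ x -ᵛ y

  Separating : Fin n → Fin n → Set
  Separating x y = x ≢ v × y ≢ v × (x ≡ y ⊎ (NonCut G x × NonCut G y))

  module _ {x y : Fin n} (x≢v : x ≢ v) (y≢v : y ≢ v) where

    cutAt-≢ : ∀ {z} → In (cutAt x y) z → z ≢ x × z ≢ y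
    cutAt-≢ p = in-delete≢ whole (x≢v ∘ sym) (mapʷ (proj₁ ∘ delete⁻ {R = delete G x}) p) , in-delete≢ (whole -ᵛ x) (y≢v ∘ sym) p

    cutAt-step : ∀ {s z} → In (cutAt x y) s → T (G s z) → z ≢ x → z ≢ y → In (cutAt x y) z
    cutAt-step p e z≢x z≢y = let (s≢x , s≢y) = cutAt-≢ p in
      in-step (cutAt x y) p (delete⁺ {R = delete G x} (delete⁺ {R = G} e s≢x z≢x) s≢y z≢y)

    cutAt-induced : Induced (cutAt x y)
    cutAt-induced p q e = let (s≢x , s≢y) = cutAt-≢ p ; (z≢x , z≢y) = cutAt-≢ q in
      delete⁺ {R = delete G x} (delete⁺ {R = G} e s≢x z≢x) s≢y z≢y

    cutAt-boundary : ∀ {z} → Boundary (cutAt x y) z → z ≡ x ⊎ z ≡ y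
    cutAt-boundary {z} (z∉ , s , p , e) with z Finₚ.≟ x | z Finₚ.≟ y
    ... | yes eq | _      = inj₁ eq
    ... | no _   | yes eq = inj₂ eq
    ... | no z≢x | no z≢y = ⊥-elim (z∉ (cutAt-step p e z≢x z≢y))

    -- If y is not a cut vertex, then x can be reached from v while avoiding y, so the component of v touches x.
    cutAt-boundaryˡ : (x ≡ y ⊎ NonCut G y) → Boundary (cutAt x y) x
    cutAt-boundaryˡ h with x Finₚ.≟ y
    ... | yes refl = let (_ , t , b , _) = exit-in (cutAt x y) id (conn v x) (λ p → proj₁ (cutAt-≢ p) refl) in
      subst (Boundary (cutAt x y)) ([ id , id ]′ (cutAt-boundary b)) b
    ... | no x≢y with h
    ...   | inj₁ eq = ⊥-elim (x≢y eq)
    ...   | inj₂ nc = let (_ , t , b , e) = exit-in (cutAt x y) (proj₁ ∘ delete⁻ {R = G}) (nc v x (y≢v ∘ sym) x≢y) (λ p → proj₁ (cutAt-≢ p) refl) in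
      subst (Boundary (cutAt x y)) ([ id , (λ eq → ⊥-elim (proj₂ (proj₂ (delete⁻ {R = G} e)) eq)) ]′ (cutAt-boundary b)) b

    cutAt-boundaryʳ : (x ≡ y ⊎ NonCut G x) → Boundary (cutAt x y) y
    cutAt-boundaryʳ h with x Finₚ.≟ y
    ... | yes refl = cutAt-boundaryˡ (inj₁ refl)
    ... | no x≢y with h
    ...   | inj₁ eq = ⊥-elim (x≢y eq)
    ...   | inj₂ nc = let (_ , t , b , e) = exit-in (cutAt x y) (proj₁ ∘ delete⁻ {R = G}) (nc v y (x≢v ∘ sym) (x≢y ∘ sym)) (λ p → proj₂ (cutAt-≢ p) refl) in
      subst (Boundary (cutAt x y)) ([ (λ eq → ⊥-elim (proj₂ (proj₂ (delete⁻ {R = G} e)) eq)) , id ]′ (cutAt-boundary b)) b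

    cutAt-notFull : ¬ Full (cutAt x y)
    cutAt-notFull f = proj₁ (cutAt-≢ (f x)) refl

  separating-boundaries : ∀ {x y} → Separating x y → Boundary (cutAt x y) x × Boundary (cutAt x y) y
  separating-boundaries (x≢v , y≢v , h) =
    cutAt-boundaryˡ x≢v y≢v ([ inj₁ , inj₂ ∘ proj₂ ]′ h) , cutAt-boundaryʳ x≢v y≢v ([ inj₁ , inj₂ ∘ proj₁ ]′ h)

  Separated : Sub → Set
  Separated A = Σ[ x ∈ Fin n ] Σ[ y ∈ Fin n ] (Separating x y × Boundary A x × Boundary A y × (∀ {z} → Boundary A z → z ≡ x ⊎ z ≡ y))

  -- The form in which equality reaches the structural argument: components outside the enumeration
  -- are excluded.
  Classified : Set
  Classified = ∀ A → Full A ⊎ (Induced A × Separated A)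

  _<ᶠ_ : Fin n → Fin n → Bool
  x <ᶠ y = isYes (x Finₚ.<? y)

  <ᶠ-asym : ∀ {x y} → x <ᶠ y ≡ y <ᶠ x → x ≡ y
  <ᶠ-asym {x} {y} eq with Finₚ.<-cmp x y
  ... | tri< lt _ _ = ⊥-elim (Finₚ.<-asym lt (toWitness {a? = y Finₚ.<? x} (T-subst eq (fromWitness {a? = x Finₚ.<? y} lt))))
  ... | tri≈ _ e _  = e
  ... | tri> _ _ gt = ⊥-elim (Finₚ.<-asym gt (toWitness {a? = x Finₚ.<? y} (T-subst (sym eq) (fromWitness {a? = y Finₚ.<? x} gt))))

  <ᶠ-irrefl : ∀ {x} → x <ᶠ x ≡ false
  <ᶠ-irrefl {x} with x Finₚ.<? x
  ... | yes p = ⊥-elim (Finₚ.<-irrefl refl p)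
  ... | no _  = refl

  -- The flag b distinguishes the two copies of every subgraph; for x ≢ y it orients the pair {x, y}.
  Triple : Set
  Triple = Fin n × Fin n × Bool

  ValidTriple : Triple → Set
  ValidTriple (x , y , b) = x ≢ v × y ≢ v × (x ≡ y ⊎ (NonCut G x × NonCut G y × b ≡ x <ᶠ y))

  valid⇒separating : ∀ {x y b} → ValidTriple (x , y , b) → Separating x y
  valid⇒separating (p , q , inj₁ eq)          = p , q , inj₁ eq
  valid⇒separating (p , q , inj₂ (a , b , _)) = p , q , inj₂ (a , b)

  crossed-triples : ∀ {x y b} → ValidTriple (x , y , b) → ValidTriple (y , x , b) → (x , y , b) ≡ (y , x , b)
  crossed-triples (_ , _ , inj₁ refl) _ = refl
  crossed-triples (_ , _ , inj₂ _) (_ , _ , inj₁ refl) = refl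
  crossed-triples {x} {y} (_ , _ , inj₂ (_ , _ , e)) (_ , _ , inj₂ (_ , _ , e′)) with refl ← <ᶠ-asym {x} {y} (trans (sym e) e′) = refl

  -- The boundary gives the set of the two vertices. The flag then gives their order, since the two
  -- orders of a pair of distinct vertices carry opposite flags.
  triple-injective : ∀ {t t′} → ValidTriple t → ValidTriple t′ →
    comp (cutAt (proj₁ t) (proj₁ (proj₂ t))) ≡ comp (cutAt (proj₁ t′) (proj₁ (proj₂ t′))) →
    proj₂ (proj₂ t) ≡ proj₂ (proj₂ t′) → t ≡ t′
  triple-injective {x , y , b} {x′ , y′ , b′} V V′ eq refl = pairs
    (from-x (proj₁ bs)) (from-x (proj₂ bs)) (from-x′ (proj₁ bs′)) (from-x′ (proj₂ bs′))
    where
    bs  = separating-boundaries (valid⇒separating V)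
    bs′ = separating-boundaries (valid⇒separating V′)
    from-x : ∀ {z} → Boundary (cutAt x y) z → z ≡ x′ ⊎ z ≡ y′
    from-x p = cutAt-boundary (proj₁ V′) (proj₁ (proj₂ V′)) (boundary-resp {cutAt x y} {cutAt x′ y′} eq p)
    from-x′ : ∀ {z} → Boundary (cutAt x′ y′) z → z ≡ x ⊎ z ≡ y
    from-x′ p = cutAt-boundary (proj₁ V) (proj₁ (proj₂ V)) (boundary-resp {cutAt x′ y′} {cutAt x y} (sym eq) p)
    pairs : x ≡ x′ ⊎ x ≡ y′ → y ≡ x′ ⊎ y ≡ y′ → x′ ≡ x ⊎ x′ ≡ y → y′ ≡ x ⊎ y′ ≡ y → (x , y , b) ≡ (x′ , y′ , b)
    pairs (inj₁ refl) (inj₂ refl) _ _           = refl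
    pairs (inj₂ refl) (inj₁ refl) _ _           = crossed-triples V V′
    pairs (inj₁ refl) (inj₁ refl) _ (inj₁ refl) = refl
    pairs (inj₁ refl) (inj₁ refl) _ (inj₂ refl) = refl
    pairs (inj₂ refl) (inj₂ refl) (inj₁ refl) _ = refl
    pairs (inj₂ refl) (inj₂ refl) (inj₂ refl) _ = refl

  full-minus-edge : ∀ {x y} → NonBridge G x y → Full (whole -ᵉ x , y)
  full-minus-edge (_ , c) z = c v z

  missing : ∀ A x y → ¬ T (graph (A -ᵉ x , y) x y)
  missing A x y t = proj₂ (deleteEdge⁻ {R = graph A} t) (inj₁ (refl , refl))

  minus-edge-notInduced : ∀ {x y} → NonBridge G x y → ¬ Induced (whole -ᵉ x , y)
  minus-edge-notInduced {x} {y} nb@(e , _) ind = missing whole x y (ind (full-minus-edge nb x) (full-minus-edge nb y) e)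

  -- If the deleted edges differ, the edge `x y` survives on the right-hand side but is missing on
  -- the left.
  minus-edge-injective : ∀ {x y x′ y′} → NonBridge G x y →
    comp (whole -ᵉ x , y) ≡ comp (whole -ᵉ x′ , y′) → (x ≡ x′ × y ≡ y′) ⊎ (x ≡ y′ × y ≡ x′)
  minus-edge-injective {x} {y} {x′} {y′} nb@(e , _) eq
    = decidable-stable (((x Finₚ.≟ x′) ×-dec (y Finₚ.≟ y′)) ⊎-dec ((x Finₚ.≟ y′) ×-dec (y Finₚ.≟ x′))) λ ¬r → missing whole x y
    (comp-edge {whole -ᵉ x′ , y′} {whole -ᵉ x , y} (sym eq)
      (full-resp {whole -ᵉ x , y} {whole -ᵉ x′ , y′} eq (full-minus-edge nb) x) (deleteEdge⁺ {R = G} (e , ¬r)))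

  module _ {x a b : Fin n} (x≢v : x ≢ v) (pend : Pendant G x) (nb : NonBridge G a b) where

    minus-both : Sub
    minus-both = (whole -ᵉ a , b) -ᵛ x

    -- Deleting a non-bridge keeps G connected and `x` pendant, and deleting a pendant vertex
    -- disconnects nothing else.
    minus-both-in : ∀ {z} → z ≢ x → In minus-both z
    minus-both-in {z} z≢x = delete-pendant (symm (whole -ᵉ a , b))
      (λ y z p q → pend y z (below (whole -ᵉ a , b) p) (below (whole -ᵉ a , b) q)) (x≢v ∘ sym) z≢x (proj₂ nb v z)

    minus-both-out : ¬ In minus-both x
    minus-both-out p = in-delete≢ (whole -ᵉ a , b) (x≢v ∘ sym) p refl

    ≢-good : ∀ {y} → Good G y → y ≢ x
    ≢-good g refl = good⇒¬pendant sG irr conn g pend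

    minus-both-notInduced : ¬ Induced minus-both
    minus-both-notInduced ind = missing whole a b (proj₁ (delete⁻ {R = deleteEdge G a b}
      (ind (minus-both-in (≢-good (nonBridge⇒good sG irr conn nb)))
           (minus-both-in (≢-good (nonBridge⇒good sG irr conn (nonBridge-sym sG nb)))) (proj₁ nb))))

  -- `x` is the only vertex missing from the component. Non-bridges avoid pendant vertices, so the
  -- surviving edges then reveal `b`; the end `a` is shared.
  minus-both-injective : ∀ {x x′ a b b′} (x≢v : x ≢ v) (x′≢v : x′ ≢ v) (pend : Pendant G x) (pend′ : Pendant G x′)
    (nb : NonBridge G a b) (nb′ : NonBridge G a b′) →
    comp (minus-both x≢v pend nb) ≡ comp (minus-both x′≢v pend′ nb′) → x ≡ x′ × b ≡ b′
  minus-both-injective {x} {x′} {a} {b} {b′} x≢v x′≢v pend pend′ nb nb′ eq = x≡x′ , b≡b′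
    where
    A = minus-both x≢v pend nb
    B = minus-both x′≢v pend′ nb′
    x≡x′ : x ≡ x′
    x≡x′ = decidable-stable (x Finₚ.≟ x′) λ x≢x′ →
      minus-both-out x≢v pend nb (comp-⊆ {B} {A} (sym eq) (minus-both-in x′≢v pend′ nb′ x≢x′))
    b≡b′ : b ≡ b′
    b≡b′ = decidable-stable (b Finₚ.≟ b′) λ b≢b′ →
      let a≢ = ≢-good x′≢v pend′ nb′ (nonBridge⇒good sG irr conn nb)
          b≢ = ≢-good x′≢v pend′ nb′ (nonBridge⇒good sG irr conn (nonBridge-sym sG nb)) in
      missing whole a b (proj₁ (delete⁻ {R = deleteEdge G a b} (comp-edge {B} {A} (sym eq)
        (minus-both-in x′≢v pend′ nb′ a≢)
        (delete⁺ {R = deleteEdge G a b′} (deleteEdge⁺ {R = G} (proj₁ nb , λ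
          { (inj₁ (_ , e)) → b≢b′ e
          ; (inj₂ (_ , e)) → edge≢ sG irr conn (proj₁ nb) e })) a≢ b≢))))

-- The doubled list of connected subgraphs containing `v`

module Enumeration {n : ℕ} (G : Graph n) (sG : Symmetric G) (irr : ∀ i → ¬ T (G i i)) (conn : Connected G) (v : Fin n)
  {N : ℕ} (count : fCount G v N) (r : Fin n) (r-good : Good G r) (r-cut : ¬ NonCut G r) where

  open ComponentCount G sG irr conn v
  open Sub

  code : Sub → Fin N
  code A = Inverse.from count (comp A)

  code-injective : ∀ {A B} → code A ≡ code B → comp A ≡ comp B
  code-injective {A} {B} eq = trans (sym (Inverse.strictlyInverseˡ count (comp A)))
    (trans (cong (Inverse.to count) eq) (Inverse.strictlyInverseˡ count (comp B)))

  without-v : List (Fin n) → List (Fin n)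
  without-v = filter (λ x → ¬? (x Finₚ.≟ v))

  ∈-without-v : ∀ {xs x} → x ∈ without-v xs → x ∈ xs × x ≢ v
  ∈-without-v = ∈-filter⁻ (λ x → ¬? (x Finₚ.≟ v))

  unique-without-v : ∀ {xs} → Unique xs → Unique (without-v xs)
  unique-without-v = Uniqueₚ.filter⁺ (λ x → ¬? (x Finₚ.≟ v))

  nonCuts cuts inner pendants : List (Fin n)
  nonCuts  = filter (nonCut? G) (allFin n)
  cuts     = filter (¬? ∘ nonCut? G) (allFin n)
  pendants = filter (pendant? G) nonCuts
  inner    = filter (¬? ∘ pendant? G) nonCuts

  ∈-nonCuts : ∀ {x} → x ∈ nonCuts → NonCut G x
  ∈-nonCuts x∈ = proj₂ (∈-filter⁻ (nonCut? G) {xs = allFin n} x∈)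

  ∈-cuts : ∀ {x} → x ∈ cuts → ¬ NonCut G x
  ∈-cuts x∈ = proj₂ (∈-filter⁻ (¬? ∘ nonCut? G) {xs = allFin n} x∈)

  ∈-pendants : ∀ {x} → x ∈ pendants → Pendant G x
  ∈-pendants x∈ = proj₂ (∈-filter⁻ (pendant? G) {xs = nonCuts} x∈)

  unique-nonCuts : Unique nonCuts
  unique-nonCuts = Uniqueₚ.filter⁺ (nonCut? G) (Uniqueₚ.allFin⁺ n)

  unique-cuts : Unique cuts
  unique-cuts = Uniqueₚ.filter⁺ (¬? ∘ nonCut? G) (Uniqueₚ.allFin⁺ n)

  unique-pendants : Unique pendants
  unique-pendants = Uniqueₚ.filter⁺ (pendant? G) unique-nonCuts

  bools : List Bool
  bools = true ∷ false ∷ []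

  unique-bools : Unique bools
  unique-bools = ((λ ()) ∷ []) ∷ [] ∷ []

  ∈-bools : ∀ b → b ∈ bools
  ∈-bools true  = here refl
  ∈-bools false = there (here refl)

  orient : Fin n × Fin n → Triple
  orient (x , y) = x , y , x <ᶠ y

  twice : Bool → Fin n → Triple
  twice b x = x , x , b

  -- Every diagonal pair occurs with both flags. `orient` gives the diagonal the flag `false`, so
  -- `triples₁` already covers that flag for the non-cut vertices, and `triples₃` adds it for the
  -- cut vertices only.
  triples₁ triples₂ triples₃ triples : List Triple
  triples₁ = map orient (cartesianProduct (without-v nonCuts) (without-v nonCuts))
  triples₂ = map (twice true) (without-v (allFin n))
  triples₃ = map (twice false) (without-v cuts)
  triples  = triples₁ ++ triples₂ ++ triples₃

  ∈-triples₁ : ∀ {t} → t ∈ triples₁ → ValidTriple t × NonCut G (proj₁ t) × proj₂ (proj₂ t) ≡ proj₁ t <ᶠ proj₁ (proj₂ t)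
  ∈-triples₁ t∈ with ∈-map⁻ orient t∈
  ... | (x , y) , xy∈ , refl with ∈-cartesianProduct⁻ (without-v nonCuts) (without-v nonCuts) xy∈
  ... | x∈ , y∈ with ∈-without-v {nonCuts} x∈ | ∈-without-v {nonCuts} y∈
  ... | x∈′ , x≢v | y∈′ , y≢v = (x≢v , y≢v , inj₂ (∈-nonCuts x∈′ , ∈-nonCuts y∈′ , refl)) , ∈-nonCuts x∈′ , refl

  ∈-twice : ∀ {b xs t} → t ∈ map (twice b) (without-v xs) → Σ[ x ∈ Fin n ] (t ≡ twice b x × x ∈ xs × x ≢ v)
  ∈-twice {b} {xs} t∈ with ∈-map⁻ (twice b) t∈
  ... | x , x∈ , refl = x , refl , ∈-without-v {xs} x∈

  valid-twice : ∀ {b xs t} → t ∈ map (twice b) (without-v xs) → ValidTriple t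
  valid-twice {b} {xs} t∈ with ∈-twice {b} {xs} t∈
  ... | x , refl , _ , x≢v = x≢v , x≢v , inj₁ refl

  ∈-triples : ∀ {t} → t ∈ triples → ValidTriple t
  ∈-triples t∈ with ∈-++⁻ triples₁ t∈
  ... | inj₁ p = proj₁ (∈-triples₁ p)
  ... | inj₂ q with ∈-++⁻ triples₂ q
  ...   | inj₁ p = valid-twice {true} {allFin n} p
  ...   | inj₂ p = valid-twice {false} {cuts} p

  unique-triples : Unique triples
  unique-triples = unique-++ {P = λ t → NonCut G (proj₁ t) × proj₂ (proj₂ t) ≡ proj₁ t <ᶠ proj₁ (proj₂ t)}
    (unique-map (λ { _ _ refl → refl }) (Uniqueₚ.cartesianProduct⁺ (unique-without-v unique-nonCuts) (unique-without-v unique-nonCuts)))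
    (unique-++ {P = λ t → proj₂ (proj₂ t) ≡ true}
      (unique-map (λ { _ _ refl → refl }) (unique-without-v (Uniqueₚ.allFin⁺ n)))
      (unique-map (λ { _ _ refl → refl }) (unique-without-v unique-cuts))
      (λ t∈ → case ∈-twice {true} {allFin n} t∈ of λ { (_ , refl , _) → refl })
      (λ t∈ → case ∈-twice {false} {cuts} t∈ of λ { (_ , refl , _) () }))
    (proj₂ ∘ ∈-triples₁)
    apart
    where
    apart : ∀ {t} → t ∈ triples₂ ++ triples₃ → ¬ (NonCut G (proj₁ t) × proj₂ (proj₂ t) ≡ proj₁ t <ᶠ proj₁ (proj₂ t))
    apart t∈ (nc , eq) with ∈-++⁻ triples₂ t∈
    ... | inj₁ p with ∈-twice {true} {allFin n} p
    ...   | x , refl , _ = case trans eq (<ᶠ-irrefl {x}) of λ ()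
    apart t∈ (nc , eq) | inj₂ p with ∈-twice {false} {cuts} p
    ...   | x , refl , x∈ , _ = ∈-cuts x∈ nc

  Object : Set
  Object = Fin N × Bool

  tripleObject : Triple → Object
  tripleObject (x , y , b) = code (cutAt x y) , b

  tripleObjects : List Object
  tripleObjects = map tripleObject triples

  unique-tripleObjects : Unique tripleObjects
  unique-tripleObjects = unique-map (λ t∈ t′∈ eq → triple-injective (∈-triples t∈) (∈-triples t′∈) (code-injective (cong proj₁ eq)) (cong proj₂ eq)) unique-triples

  wholeObjects : List Object
  wholeObjects = map (code whole ,_) bools

  unique-wholeObjects : Unique wholeObjects
  unique-wholeObjects = unique-map {f = code whole ,_} (λ { _ _ refl → refl }) unique-bools

  chosen : ∀ {x} → Dec (Good G x) → Bool → Fin n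
  chosen (yes (y , _))     true  = y
  chosen (yes (_ , z , _)) false = z
  -- An arbitrary default; the lemmas on `chosen` assume that `x` is good.
  chosen {x} (no _)        _     = x

  chosen-nonBridge : ∀ {x} (d : Dec (Good G x)) → Good G x → ∀ j → NonBridge G x (chosen d j)
  chosen-nonBridge (yes (_ , _ , _ , p , _)) _ true  = p
  chosen-nonBridge (yes (_ , _ , _ , _ , q)) _ false = q
  chosen-nonBridge (no ¬g) g _ = ⊥-elim (¬g g)

  chosen-injective : ∀ {x} (d : Dec (Good G x)) → Good G x → ∀ {i j} → chosen d i ≡ chosen d j → i ≡ j
  chosen-injective (yes _) _ {true}  {true}  _ = refl
  chosen-injective (yes _) _ {false} {false} _ = refl
  chosen-injective (yes (_ , _ , y≢z , _)) _ {true}  {false} eq = ⊥-elim (y≢z eq)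
  chosen-injective (yes (_ , _ , y≢z , _)) _ {false} {true}  eq = ⊥-elim (y≢z (sym eq))
  chosen-injective (no ¬g) g _ = ⊥-elim (¬g g)

  nbr : Fin n → Bool → Fin n
  nbr x = chosen (good? G x)

  nbr-nonBridge : ∀ {x} → Good G x → ∀ j → NonBridge G x (nbr x j)
  nbr-nonBridge {x} = chosen-nonBridge (good? G x)

  nbr-injective : ∀ {x} → Good G x → ∀ {i j} → nbr x i ≡ nbr x j → i ≡ j
  nbr-injective {x} = chosen-injective (good? G x)

  neighbour : ∀ {x} → Σ[ y ∈ Fin n ] T (G x y)
  neighbour {x} with x Finₚ.≟ r
  ... | yes refl = let (y , _ , _ , (e , _) , _) = r-good in y , e
  ... | no x≢r with conn x r
  ...   | here = ⊥-elim (x≢r refl)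
  ...   | step e _ = _ , e

  ∈-inner : ∀ {x} → x ∈ r ∷ inner → Good G x
  ∈-inner (here refl) = r-good
  ∈-inner (there x∈) with ∈-filter⁻ (¬? ∘ pendant? G) {xs = nonCuts} x∈
  ... | x∈′ , ¬pend = nonBridge⇒good sG irr conn (nonCut-nonBridge sG irr conn (∈-nonCuts x∈′) ¬pend (proj₂ neighbour))

  edgeKeys : List (Fin n × Bool)
  edgeKeys = cartesianProduct (r ∷ inner) bools

  unique-edgeKeys : Unique edgeKeys
  unique-edgeKeys = Uniqueₚ.cartesianProduct⁺
    (unique-∷ (λ r∈ → r-cut (∈-nonCuts (proj₁ (∈-filter⁻ (¬? ∘ pendant? G) {xs = nonCuts} r∈))))
      (Uniqueₚ.filter⁺ (¬? ∘ pendant? G) unique-nonCuts)) unique-bools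

  edgeSub : Fin n × Bool → Sub
  edgeSub (x , j) = whole -ᵉ x , nbr x j

  -- The flag records from which end the edge is listed, so an edge chosen at both of its ends
  -- yields two different objects.
  edgeObject : Fin n × Bool → Object
  edgeObject (x , j) = code (edgeSub (x , j)) , x <ᶠ nbr x j

  edgeObjects : List Object
  edgeObjects = map edgeObject edgeKeys

  ∈-edgeKeys : ∀ {k} → k ∈ edgeKeys → Good G (proj₁ k)
  ∈-edgeKeys k∈ = ∈-inner (proj₁ (∈-cartesianProduct⁻ (r ∷ inner) bools k∈))

  edgeObject-injective : ∀ {k k′} → k ∈ edgeKeys → k′ ∈ edgeKeys → edgeObject k ≡ edgeObject k′ → k ≡ k′
  edgeObject-injective {x , j} {x′ , j′} k∈ k′∈ eq =
    match (minus-edge-injective (nbr-nonBridge g j) (code-injective (cong proj₁ eq))) (cong proj₂ eq)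
    where
    g = ∈-edgeKeys k∈
    match : (x ≡ x′ × nbr x j ≡ nbr x′ j′) ⊎ (x ≡ nbr x′ j′ × nbr x j ≡ x′) → x <ᶠ nbr x j ≡ x′ <ᶠ nbr x′ j′ → (x , j) ≡ (x′ , j′)
    match (inj₁ (refl , e)) _ = cong (x ,_) (nbr-injective g e)
    match (inj₂ (e , e′)) f = ⊥-elim (edge≢ sG irr conn (proj₁ (nbr-nonBridge g j))
      (trans e′ (<ᶠ-asym {x′} {x} (trans (trans (cong (x′ <ᶠ_) e) (sym f)) (cong (x <ᶠ_) e′)))))

  unique-edgeObjects : Unique edgeObjects
  unique-edgeObjects = unique-map edgeObject-injective unique-edgeKeys

  PendantKey : Set
  PendantKey = Fin n × Bool × Bool

  -- Two non-bridges at `r` and two flags make four entries for each pendant vertex, against the two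
  -- that an inner vertex has in `edgeKeys`.
  pendantKeys : List PendantKey
  pendantKeys = cartesianProduct (without-v pendants) (cartesianProduct bools bools)

  pendantSub : PendantKey → Sub
  pendantSub (x , j , _) = (whole -ᵉ r , nbr r j) -ᵛ x

  pendantObject : PendantKey → Object
  pendantObject (x , j , b) = code (pendantSub (x , j , b)) , b

  pendantObjects : List Object
  pendantObjects = map pendantObject pendantKeys

  ∈-pendantKeys : ∀ {k} → k ∈ pendantKeys → Pendant G (proj₁ k) × proj₁ k ≢ v
  ∈-pendantKeys k∈ with ∈-without-v {pendants} (proj₁ (∈-cartesianProduct⁻ (without-v pendants) (cartesianProduct bools bools) k∈))
  ... | x∈ , x≢v = ∈-pendants x∈ , x≢v

  pendantObject-injective : ∀ {k k′} → k ∈ pendantKeys → k′ ∈ pendantKeys → pendantObject k ≡ pendantObject k′ → k ≡ k′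
  pendantObject-injective {x , j , b} {x′ , j′ , b′} k∈ k′∈ eq =
    let (pend , x≢v) = ∈-pendantKeys k∈ ; (pend′ , x′≢v) = ∈-pendantKeys k′∈
        (p , q) = minus-both-injective x≢v x′≢v pend pend′ (nbr-nonBridge r-good j) (nbr-nonBridge r-good j′) (code-injective (cong proj₁ eq))
    in cong₂ _,_ p (cong₂ _,_ (nbr-injective r-good q) (cong proj₂ eq))

  unique-pendantObjects : Unique pendantObjects
  unique-pendantObjects = unique-map pendantObject-injective
    (Uniqueₚ.cartesianProduct⁺ (unique-without-v unique-pendants) (Uniqueₚ.cartesianProduct⁺ unique-bools unique-bools))

  objects : List Object
  objects = (tripleObjects ++ wholeObjects) ++ (edgeObjects ++ pendantObjects)

  Realises : (Sub → Set) → Object → Set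
  Realises P o = Σ[ A ∈ Sub ] (P A × code A ≡ proj₁ o)

  tripleObject-not-full : ∀ {o} → o ∈ tripleObjects → ¬ Realises Full o
  tripleObject-not-full o∈ (A , f , eq) with ∈-map⁻ tripleObject o∈
  ... | (x , y , b) , t∈ , refl = let (x≢v , y≢v , _) = ∈-triples t∈ in
    cutAt-notFull x≢v y≢v (full-resp {A} (code-injective eq) f)

  wholeObject-full : ∀ {o} → o ∈ wholeObjects → Realises Full o
  wholeObject-full o∈ with ∈-map⁻ (code whole ,_) o∈
  ... | b , _ , refl = whole , (λ z → conn v z) , refl

  induced-objects : ∀ {o} → o ∈ tripleObjects ++ wholeObjects → Realises Induced o
  induced-objects o∈ with ∈-++⁻ tripleObjects o∈
  ... | inj₁ p with ∈-map⁻ tripleObject p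
  ...   | (x , y , b) , t∈ , refl = let (x≢v , y≢v , _) = ∈-triples t∈ in cutAt x y , cutAt-induced x≢v y≢v , refl
  induced-objects o∈ | inj₂ p with ∈-map⁻ (code whole ,_) p
  ...   | b , _ , refl = whole , (λ _ _ e → e) , refl

  edgeObject-full : ∀ {o} → o ∈ edgeObjects → Realises Full o
  edgeObject-full o∈ with ∈-map⁻ edgeObject o∈
  ... | (x , j) , k∈ , refl = edgeSub (x , j) , full-minus-edge (nbr-nonBridge (∈-edgeKeys k∈) j) , refl

  pendantObject-not-full : ∀ {o} → o ∈ pendantObjects → ¬ Realises Full o
  pendantObject-not-full o∈ (A , f , eq) with ∈-map⁻ pendantObject o∈
  ... | (x , j , b) , k∈ , refl = let (pend , x≢v) = ∈-pendantKeys k∈ in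
    minus-both-out x≢v pend (nbr-nonBridge r-good j) (full-resp {A} (code-injective eq) f x)

  non-induced-objects : ∀ {o} → o ∈ edgeObjects ++ pendantObjects → ¬ Realises Induced o
  non-induced-objects o∈ (A , ind , eq) with ∈-++⁻ edgeObjects o∈
  ... | inj₁ p with ∈-map⁻ edgeObject p
  ...   | (x , j) , k∈ , refl = minus-edge-notInduced (nbr-nonBridge (∈-edgeKeys k∈) j) (induced-resp {A} {edgeSub (x , j)} (code-injective eq) ind)
  non-induced-objects o∈ (A , ind , eq) | inj₂ p with ∈-map⁻ pendantObject p
  ...   | (x , j , b) , k∈ , refl = let (pend , x≢v) = ∈-pendantKeys k∈ in
    minus-both-notInduced x≢v pend (nbr-nonBridge r-good j) (induced-resp {A} {pendantSub (x , j , b)} (code-injective eq) ind)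

  -- Two invariants separate the four families: triples are induced but not full, the whole graph is
  -- both, a deleted edge leaves a full subgraph that is not induced, and the pendant family is
  -- neither.
  unique-objects : Unique objects
  unique-objects = unique-++ {P = Realises Induced}
    (Uniqueₚ.++⁺ unique-tripleObjects unique-wholeObjects (λ (p , q) → tripleObject-not-full p (wholeObject-full q)))
    (Uniqueₚ.++⁺ unique-edgeObjects unique-pendantObjects (λ (p , q) → pendantObject-not-full q (edgeObject-full p)))
    induced-objects non-induced-objects

  allObjects : List Object
  allObjects = cartesianProduct (allFin N) bools

  ∈-allObjects : ∀ {o} → o ∈ allObjects
  ∈-allObjects = ∈-cartesianProduct⁺ (∈-allFin _) (∈-bools _)

  length-allObjects : length allObjects ≡ N * 2
  length-allObjects = trans (length-cartesianProduct (allFin N) bools) (cong (_* 2) (length-allFin N))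

  length-objects≤ : length objects ≤ N * 2
  length-objects≤ = subst (length objects ≤_) length-allObjects (unique-⊆⇒length≤ unique-objects (λ _ → ∈-allObjects))

  _≟ᵒ_ : (o o′ : Object) → Dec (o ≡ o′)
  _≟ᵒ_ = ×ₚ.≡-dec Finₚ._≟_ Boolₚ._≟_

  separated-triple : ∀ A {b} → (code A , b) ∈ tripleObjects → Induced A × Separated A
  separated-triple A o∈ = let
      ((x , y , b) , t∈ , eq) = ∈-map⁻ tripleObject o∈
      eq′ = code-injective {cutAt x y} {A} (sym (cong proj₁ eq))
      sep = valid⇒separating (∈-triples t∈)
      (x≢v , y≢v , _) = sep
      (bˡ , bʳ) = separating-boundaries sep
    in induced-resp {cutAt x y} {A} eq′ (cutAt-induced x≢v y≢v) ,
       x , y , sep , boundary-resp {cutAt x y} {A} eq′ bˡ , boundary-resp {cutAt x y} {A} eq′ bʳ ,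
       λ p → cutAt-boundary x≢v y≢v (boundary-resp {A} {cutAt x y} (sym eq′) p)

  full-object : ∀ A {b} → Realises Full (code A , b) → Full A
  full-object A (B , f , eq) = full-resp {B} {A} (code-injective eq) f

  no-pendantObject : without-v pendants ≡ [] → ∀ {o} → o ∉ pendantObjects
  no-pendantObject none o∈ = let
      (k , k∈ , _) = ∈-map⁻ pendantObject o∈
      x∈ = proj₁ (∈-cartesianProduct⁻ (without-v pendants) (cartesianProduct bools bools) k∈)
    in case subst (proj₁ k ∈_) none x∈ of λ ()

  -- The enumeration is exhaustive when its length attains the maximum 2N.
  classify : N * 2 ≤ length objects → without-v pendants ≡ [] → Classified
  classify len none A =
    [ [ inj₂ ∘ separated-triple A , inj₁ ∘ full-object A {true} ∘ wholeObject-full ]′ ∘ ∈-++⁻ tripleObjects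
    , [ inj₁ ∘ full-object A {true} ∘ edgeObject-full , ⊥-elim ∘ no-pendantObject none ]′ ∘ ∈-++⁻ edgeObjects
    ]′ (∈-++⁻ (tripleObjects ++ wholeObjects)
      (unique-exhaustive _≟ᵒ_ unique-objects (λ {o} → ∈-allObjects {o}) (subst (_≤ length objects) (sym length-allObjects) len) (code A , true)))

  length-objects : length objects ≡
    ((length (without-v nonCuts) * length (without-v nonCuts) + (length (without-v (allFin n)) + length (without-v cuts))) + 2)
    + (suc (length inner) * 2 + length (without-v pendants) * 4)
  length-objects = trans (Listₚ.length-++ (tripleObjects ++ wholeObjects)) (cong₂ _+_
    (trans (Listₚ.length-++ tripleObjects) (cong (_+ 2) (trans (Listₚ.length-map tripleObject triples)
      (trans (Listₚ.length-++ triples₁) (cong₂ _+_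
        (trans (Listₚ.length-map orient (cartesianProduct (without-v nonCuts) (without-v nonCuts))) (length-cartesianProduct (without-v nonCuts) (without-v nonCuts)))
        (trans (Listₚ.length-++ triples₂) (cong₂ _+_
          (Listₚ.length-map (twice true) (without-v (allFin n))) (Listₚ.length-map (twice false) (without-v cuts)))))))))
    (trans (Listₚ.length-++ edgeObjects) (cong₂ _+_
      (trans (Listₚ.length-map edgeObject edgeKeys) (length-cartesianProduct (r ∷ inner) bools))
      (trans (Listₚ.length-map pendantObject pendantKeys) (length-cartesianProduct (without-v pendants) (cartesianProduct bools bools))))))

-- Positions in lists and adjacency in `L n c`

data At {A : Set} : List A → ℕ → A → Set where
  hd : ∀ {x xs} → At (x ∷ xs) 0 x
  tl : ∀ {x y xs i} → At xs i x → At (y ∷ xs) (suc i) x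

module _ {A : Set} where

  at-∈ : ∀ {l : List A} {i x} → At l i x → x ∈ l
  at-∈ hd     = here refl
  at-∈ (tl p) = there (at-∈ p)

  at-index : ∀ {l : List A} {x} (x∈ : x ∈ l) → At l (toℕ (index x∈)) x
  at-index (here refl) = hd
  at-index (there x∈)  = tl (at-index x∈)

  at-position : ∀ {l : List A} → Unique l → ∀ {i j x} → At l i x → At l j x → i ≡ j
  at-position u hd     hd     = refl
  at-position u hd     (tl q) = ⊥-elim (unique-head∉ u (at-∈ q))
  at-position u (tl p) hd     = ⊥-elim (unique-head∉ u (at-∈ p))
  at-position (_ ∷ u) (tl p) (tl q) = cong suc (at-position u p q)

  at-element : ∀ {l : List A} {i x y} → At l i x → At l i y → x ≡ y
  at-element hd     hd     = refl
  at-element (tl p) (tl q) = at-element p q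

  at-++ : ∀ (xs : List A) {y ys} → At (xs ++ y ∷ ys) (length xs) y
  at-++ []       = hd
  at-++ (x ∷ xs) = tl (at-++ xs)

LEdge : ℕ → ℕ → ℕ → Set
LEdge c i j = suc i ≡ j ⊎ (i ≡ 0 × j ≡ c ∸ 1)

lEdge⁻ : ∀ c i j → T (lEdge c i j) → LEdge c i j
lEdge⁻ c i j t with T-∨⁻ {suc i ≡ᵇ j} t
... | inj₁ p = inj₁ (ℕₚ.≡ᵇ⇒≡ (suc i) j p)
... | inj₂ q = let (a , b) = T-∧⁻ {i ≡ᵇ 0} q in inj₂ (ℕₚ.≡ᵇ⇒≡ i 0 a , ℕₚ.≡ᵇ⇒≡ j (c ∸ 1) b)

lEdge⁺ : ∀ c i j → LEdge c i j → T (lEdge c i j)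
lEdge⁺ c i j (inj₁ p)       = T-∨⁺ {suc i ≡ᵇ j} (inj₁ (ℕₚ.≡⇒≡ᵇ (suc i) j p))
lEdge⁺ c i j (inj₂ (p , q)) = T-∨⁺ {suc i ≡ᵇ j} (inj₂ (T-∧⁺ {i ≡ᵇ 0} (ℕₚ.≡⇒≡ᵇ i 0 p) (ℕₚ.≡⇒≡ᵇ j (c ∸ 1) q)))

L⁻ : ∀ {n} c (i j : Fin n) → T (L n c i j) → LEdge c (toℕ i) (toℕ j) ⊎ LEdge c (toℕ j) (toℕ i)
L⁻ c i j t with T-∨⁻ {lEdge c (toℕ i) (toℕ j)} (proj₂ (T-∧⁻ {not (toℕ i ≡ᵇ toℕ j)} t))
... | inj₁ p = inj₁ (lEdge⁻ c (toℕ i) (toℕ j) p)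
... | inj₂ p = inj₂ (lEdge⁻ c (toℕ j) (toℕ i) p)

L⁺ : ∀ {n} c (i j : Fin n) → toℕ i ≢ toℕ j → LEdge c (toℕ i) (toℕ j) ⊎ LEdge c (toℕ j) (toℕ i) → T (L n c i j)
L⁺ c i j i≢j h = T-∧⁺ (T-not (i≢j ∘ ℕₚ.≡ᵇ⇒≡ (toℕ i) (toℕ j))) (T-∨⁺ {lEdge c (toℕ i) (toℕ j)}
  ([ inj₁ ∘ lEdge⁺ c (toℕ i) (toℕ j) , inj₂ ∘ lEdge⁺ c (toℕ j) (toℕ i) ]′ h))

-- If every component subgraph is full or has one of the enumerated boundaries, then adding boundary vertices one at a time
-- from v traverses a path up to a vertex w with two outer neighbours x and y, and from there a cycle through w, x and y.

module Extremal {n : ℕ} (G : Graph n) (sG : Symmetric G) (irr : ∀ i → ¬ T (G i i)) (conn : Connected G) (v : Fin n)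
  (classify : ComponentCount.Classified G sG irr conn v)
  (v-pendant : Pendant G v) (only-v : ∀ {x} → Pendant G x → x ≡ v)
  (r : Fin n) (r≢v : r ≢ v) where

  open ComponentCount G sG irr conn v
  open Sub

  _∈?_ : (z : Fin n) (l : List (Fin n)) → Dec (z ∈ l)
  _∈?_ = DecMem._∈?_ Finₚ._≟_

  Restricted : List (Fin n) → Fin n → Fin n → Set
  Restricted l i j = T (G i j) × i ∈ l × j ∈ l

  abstract
    restricted? : ∀ l i j → Dec (Restricted l i j)
    restricted? l i j = Boolₚ.T? (G i j) ×-dec ((i ∈? l) ×-dec (j ∈? l))

  restrict⁺ : ∀ {l i j} → Restricted l i j → T (isYes (restricted? l i j))
  restrict⁺ {l} {i} {j} = fromWitness {a? = restricted? l i j}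

  restrict⁻ : ∀ {l i j} → T (isYes (restricted? l i j)) → Restricted l i j
  restrict⁻ {l} {i} {j} = toWitness {a? = restricted? l i j}

  restrict : List (Fin n) → Sub
  restrict l = sub (λ i j → isYes (restricted? l i j)) (λ i j → T⇔→≡ (flip′ i j) (flip′ j i)) (λ {i} {j} → proj₁ ∘ restrict⁻ {l} {i} {j})
    where
    flip′ : ∀ i j → T (isYes (restricted? l i j)) → T (isYes (restricted? l j i))
    flip′ i j t = let (e , p , q) = restrict⁻ {l} {i} {j} t in restrict⁺ {l} {j} {i} (swap sG e , q , p)

  -- A witness that the list induces a connected subgraph containing `v`, so that the component of
  -- `v` in `restrict l` has exactly the vertices of `l`.
  data Grown : List (Fin n) → Set where
    start : Grown (v ∷ [])
    add   : ∀ {x s l} → Grown l → s ∈ l → T (G s x) → Grown (x ∷ l)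

  v∈grown : ∀ {l} → Grown l → v ∈ l
  v∈grown start       = here refl
  v∈grown (add g _ _) = there (v∈grown g)

  grown-in : ∀ {l} → Grown l → ∀ {z} → z ∈ l → In (restrict l) z
  grown-in start (here refl) = here
  grown-in {x ∷ l} (add {s = s} g s∈ e) z∈ = go z∈
    where
    weaken : ∀ {z} → In (restrict l) z → In (restrict (x ∷ l)) z
    weaken = mapʷ λ {a} {b} t → let (e , p , q) = restrict⁻ {l} {a} {b} t in restrict⁺ {x ∷ l} {a} {b} (e , there p , there q)
    go : ∀ {z} → z ∈ x ∷ l → In (restrict (x ∷ l)) z
    go (there z∈)  = weaken (grown-in g z∈)
    go (here refl) = in-step (restrict (x ∷ l)) (weaken (grown-in g s∈)) (restrict⁺ {x ∷ l} {s} {x} (e , there s∈ , here refl))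

  in-grown : ∀ {l} → v ∈ l → ∀ {z} → In (restrict l) z → z ∈ l
  in-grown {l} v∈ p = go v∈ p
    where
    go : ∀ {u z} → u ∈ l → Walk (graph (restrict l)) u z → z ∈ l
    go u∈ here = u∈
    go u∈ (step {u} {w} e p) = go (proj₂ (proj₂ (restrict⁻ {l} {u} {w} e))) p

  ListBoundary : List (Fin n) → Fin n → Set
  ListBoundary l z = z ∉ l × (Σ[ s ∈ Fin n ] (s ∈ l × T (G s z)))

  classify-list : ∀ {l} → Grown l → ∀ {z} → z ∉ l →
    Σ[ x ∈ Fin n ] Σ[ y ∈ Fin n ] (Separating x y × ListBoundary l x × ListBoundary l y × (∀ {z} → ListBoundary l z → z ≡ x ⊎ z ≡ y))
  classify-list {l} g {z} z∉ with classify (restrict l)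
  ... | inj₁ f = ⊥-elim (z∉ (in-grown (v∈grown g) (f z)))
  ... | inj₂ (_ , x , y , sep , bx , by , only) = x , y , sep , to bx , to by , only ∘ from
    where
    to : ∀ {z} → Boundary (restrict l) z → ListBoundary l z
    to (z∉ , s , s∈ , e) = z∉ ∘ grown-in g , s , in-grown (v∈grown g) s∈ , e
    from : ∀ {z} → ListBoundary l z → Boundary (restrict l) z
    from (z∉ , s , s∈ , e) = z∉ ∘ in-grown (v∈grown g) , s , grown-in g s∈ , e

  -- Lists are in reverse order of visit, so that positions match the vertices of L n c.

  data Chain : List (Fin n) → Set where
    start : Chain (v ∷ [])
    next  : ∀ {x h us} → Chain (h ∷ us) → x ∉ h ∷ us → T (G h x) → (∀ {z} → z ∉ h ∷ us → T (G h z) → z ≡ x) → Chain (x ∷ h ∷ us)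

  -- The traversal has reached the branching vertex `w` and goes on along one side. `y`, the first
  -- vertex of the other side, stays outside until the cycle closes.
  data Fork (y w : Fin n) (ps : List (Fin n)) : List (Fin n) → Set where
    fork : ∀ {x} → Chain (w ∷ ps) → x ∉ w ∷ ps → y ∉ w ∷ ps → x ≢ y → T (G w x) → T (G w y) →
      (∀ {z} → z ∉ w ∷ ps → T (G w z) → z ≡ x ⊎ z ≡ y) → NonCut G x → NonCut G y → Fork y w ps (x ∷ [])
    next : ∀ {x a xs} → Fork y w ps (a ∷ xs) → x ∉ (a ∷ xs) ++ w ∷ ps → x ≢ y → T (G a x) →
      (∀ {z} → z ∉ (a ∷ xs) ++ w ∷ ps → T (G a z) → z ≡ x) → NonCut G x → Fork y w ps (x ∷ a ∷ xs)

  -- Induced paths: what chains and forks have in common once the conditions on outside neighbours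
  -- are forgotten.
  data Linear : List (Fin n) → Set where
    single : ∀ {x} → Linear (x ∷ [])
    next   : ∀ {x h us} → Linear (h ∷ us) → T (G h x) → (∀ {b} → b ∈ us → ¬ T (G b x)) → Linear (x ∷ h ∷ us)

  linear-adjacent : ∀ {l} → Linear l → ∀ {i j a b} → i < j → At l i a → At l j b → T (G b a) → suc i ≡ j
  linear-adjacent (next ℓ e f) _ hd (tl hd) _ = refl
  linear-adjacent (next ℓ e f) _ hd (tl (tl q)) t = ⊥-elim (f (at-∈ q) t)
  linear-adjacent (next ℓ e f) (s≤s lt) (tl p) (tl q) t = cong suc (linear-adjacent ℓ lt p q t)
  linear-adjacent single () hd hd _
  linear-adjacent single _ hd (tl ()) _
  linear-adjacent single _ (tl ()) _ _

  linear-edge : ∀ {l} → Linear l → ∀ {i a b} → At l i a → At l (suc i) b → T (G b a)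
  linear-edge (next ℓ e f) hd (tl hd) = e
  linear-edge (next ℓ e f) (tl p) (tl q) = linear-edge ℓ p q
  linear-edge single hd (tl ())
  linear-edge single (tl ()) _

  chain-grown : ∀ {l} → Chain l → Grown l
  chain-grown start          = start
  chain-grown (next c _ e _) = add (chain-grown c) (here refl) e

  chain-unique : ∀ {l} → Chain l → Unique l
  chain-unique start           = [] ∷ []
  chain-unique (next c x∉ _ _) = unique-∷ x∉ (chain-unique c)

  -- Each vertex behind the head had a single neighbour outside the list when it was the head, and
  -- that neighbour was added next.
  chain-closed : ∀ {h us} → Chain (h ∷ us) → ∀ {s z} → s ∈ us → T (G s z) → z ∈ h ∷ us
  chain-closed start () _
  chain-closed {h} {us} (next c _ _ f) {z = z} (here refl) e with z ∈? us
  ... | yes z∈ = there z∈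
  ... | no z∉  = here (f z∉ e)
  chain-closed (next c _ _ _) (there s∈) e = there (chain-closed c s∈ e)

  chain-linear : ∀ {l} → Chain l → Linear l
  chain-linear start           = single
  chain-linear (next c x∉ e _) = next (chain-linear c) e λ b∈ t → x∉ (chain-closed c b∈ t)

  chain-last : ∀ {l} → Chain l → Σ[ i ∈ ℕ ] (suc i ≡ length l × At l i v)
  chain-last start          = 0 , refl , hd
  chain-last (next c _ _ _) = let (i , eq , p) = chain-last c in suc i , cong suc eq , tl p

  linear-pendant : ∀ {x h us} → Linear (x ∷ h ∷ us) → (∀ {z} → T (G x z) → z ∈ h ∷ us) → Pendant G x
  linear-pendant {x} {h} {us} (next _ _ f) nbrs y z p q = trans (is-h p (nbrs p)) (sym (is-h q (nbrs q)))
    where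
    is-h : ∀ {y} → T (G x y) → y ∈ h ∷ us → y ≡ h
    is-h p (here eq)  = eq
    is-h p (there y∈) = ⊥-elim (f y∈ (swap sG p))

  -- A chain never exhausts G: its head would then be a pendant vertex other than `v`. The
  -- one-vertex chain misses `r`.
  chain-missing : ∀ {l} → Chain l → Σ[ z ∈ Fin n ] z ∉ l
  chain-missing {l} c with Finₚ.all? (_∈? l)
  ... | no ¬all = let (z , z∉ , _) = Finₚ.¬∀⟶∃¬-smallest n (_∈ l) (_∈? l) ¬all in z , z∉
  chain-missing start | yes all with all r
  ... | here eq = ⊥-elim (r≢v eq)
  chain-missing c@(next {x} {h} {us} c′ x∉ _ _) | yes all = ⊥-elim (x∉ (subst (_∈ h ∷ us) (sym x≡v) (v∈grown (chain-grown c′))))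
    where
    x≡v : x ≡ v
    x≡v = only-v (linear-pendant (chain-linear c) λ {z} e → case all z of λ
      { (here refl) → ⊥-elim (irr _ e) ; (there z∈) → z∈ })

  module _ {y w : Fin n} {ps : List (Fin n)} where

    fork-grown : ∀ {xs} → Fork y w ps xs → Grown (xs ++ w ∷ ps)
    fork-grown (fork c _ _ _ e _ _ _ _) = add (chain-grown c) (here refl) e
    fork-grown (next k _ _ e _ _)       = add (fork-grown k) (here refl) e

    fork-unique : ∀ {xs} → Fork y w ps xs → Unique (xs ++ w ∷ ps)
    fork-unique (fork c x∉ _ _ _ _ _ _ _) = unique-∷ x∉ (chain-unique c)
    fork-unique (next k x∉ _ _ _ _)       = unique-∷ x∉ (fork-unique k)

    fork-chain : ∀ {xs} → Fork y w ps xs → Chain (w ∷ ps)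
    fork-chain (fork c _ _ _ _ _ _ _ _) = c
    fork-chain (next k _ _ _ _ _)       = fork-chain k

    fork-y∉ : ∀ {xs} → Fork y w ps xs → y ∉ xs ++ w ∷ ps
    fork-y∉ (fork _ _ y∉ x≢y _ _ _ _ _) (here eq)  = x≢y (sym eq)
    fork-y∉ (fork _ _ y∉ x≢y _ _ _ _ _) (there y∈) = y∉ y∈
    fork-y∉ (next k _ x≢y _ _ _) (here eq)  = x≢y (sym eq)
    fork-y∉ (next k _ x≢y _ _ _) (there y∈) = fork-y∉ k y∈

    fork-wy : ∀ {xs} → Fork y w ps xs → T (G w y)
    fork-wy (fork _ _ _ _ _ e _ _ _) = e
    fork-wy (next k _ _ _ _ _)       = fork-wy k

    fork-nonCuts : ∀ {xs} → Fork y w ps xs → ∀ {x} → x ∈ y ∷ xs → NonCut G x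
    fork-nonCuts (fork _ _ _ _ _ _ _ _ nc)  (here refl)         = nc
    fork-nonCuts (fork _ _ _ _ _ _ _ nc _)  (there (here refl)) = nc
    fork-nonCuts (next k _ _ _ _ nc) (here refl)         = fork-nonCuts k (here refl)
    fork-nonCuts (next k _ _ _ _ nc) (there (here refl)) = nc
    fork-nonCuts (next k _ _ _ _ nc) (there (there x∈))  = fork-nonCuts k (there x∈)

    -- Behind the head, the only edge that leaves the list is the one from `w` to `y`.
    fork-closed : ∀ {a xs} → Fork y w ps (a ∷ xs) → ∀ {s z} → s ∈ xs ++ w ∷ ps → T (G s z) → z ∈ (a ∷ xs) ++ w ∷ ps ⊎ (z ≡ y × s ≡ w)
    fork-closed (fork c _ _ _ _ _ f _ _) {z = z} (here refl) e with z ∈? (w ∷ ps)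
    ... | yes z∈ = inj₁ (there z∈)
    ... | no z∉ with f z∉ e
    ...   | inj₁ eq = inj₁ (here eq)
    ...   | inj₂ eq = inj₂ (eq , refl)
    fork-closed (fork c _ _ _ _ _ _ _ _) (there s∈) e = inj₁ (there (chain-closed c s∈ e))
    fork-closed (next {a = a} {xs} k _ _ _ f _) {z = z} (here refl) e with z ∈? ((a ∷ xs) ++ w ∷ ps)
    ... | yes z∈ = inj₁ (there z∈)
    ... | no z∉  = inj₁ (here (f z∉ e))
    fork-closed (next k _ _ _ _ _) (there s∈) e with fork-closed k s∈ e
    ... | inj₁ z∈ = inj₁ (there z∈)
    ... | inj₂ eq = inj₂ eq

    fork-linear : ∀ {xs} → Fork y w ps xs → Linear (xs ++ w ∷ ps)
    fork-linear (fork c x∉ _ _ e _ _ _ _) = next (chain-linear c) e λ b∈ t → x∉ (chain-closed c b∈ t)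
    fork-linear (next k x∉ x≢y e _ _)     = next (fork-linear k) e λ b∈ t → [ x∉ , x≢y ∘ proj₁ ]′ (fork-closed k b∈ t)

    fork-w∈ : ∀ {a xs} → Fork y w ps (a ∷ xs) → w ∈ xs ++ w ∷ ps
    fork-w∈ {xs = xs} _ = ∈-++⁺ʳ xs (here refl)

    fork-last : ∀ {a xs} → Fork y w ps (a ∷ xs) → Σ[ i ∈ ℕ ] (suc i ≡ length ((a ∷ xs) ++ w ∷ ps) × At ((a ∷ xs) ++ w ∷ ps) i v)
    fork-last (fork c _ _ _ _ _ _ _ _) = let (i , eq , p) = chain-last c in suc i , cong suc eq , tl p
    fork-last (next k _ _ _ _ _)       = let (i , eq , p) = fork-last k in suc i , cong suc eq , tl p

    -- The branching vertex has two neighbours `x` and `y`, so it is not the pendant vertex `v`.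
    fork-v∈ps : ∀ {xs} → Fork y w ps xs → v ∈ ps
    fork-v∈ps (next k _ _ _ _ _) = fork-v∈ps k
    fork-v∈ps (fork c _ _ x≢y e f _ _ _) with v∈grown (chain-grown c)
    ... | there v∈  = v∈
    ... | here refl = ⊥-elim (x≢y (v-pendant _ _ e f))

    -- Otherwise deleting the edge wy leaves a connected subgraph that is neither induced nor full.
    fork-no-chord : ∀ {a xs} → Fork y w ps (a ∷ xs) → ∀ {z} → z ∉ y ∷ (a ∷ xs) ++ w ∷ ps → ¬ T (G a y)
    fork-no-chord {a} {xs} k {z} z∉ ay with classify (restrict (y ∷ (a ∷ xs) ++ w ∷ ps) -ᵉ w , y)
    ... | inj₁ f = z∉ (in-grown (there (v∈grown (fork-grown k))) (mapʷ (proj₁ ∘ deleteEdge⁻ {R = graph (restrict (y ∷ (a ∷ xs) ++ w ∷ ps))}) (f z)))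
    ... | inj₂ (ind , _) = missing (restrict l′) w y (ind (in-l (there (fork-w∈ k))) y-in (fork-wy k))
      where
      l  = (a ∷ xs) ++ w ∷ ps
      l′ = y ∷ l
      A = restrict l′ -ᵉ w , y
      in-l : ∀ {z} → z ∈ l → In A z
      in-l z∈ = mapʷ (λ {i} {j} t → let (e , p , q) = restrict⁻ {l} {i} {j} t in
          deleteEdge⁺ {R = graph (restrict l′)} (restrict⁺ {l′} {i} {j} (e , there p , there q) , λ
            { (inj₁ (_ , refl)) → fork-y∉ k q ; (inj₂ (refl , _)) → fork-y∉ k p })) (grown-in (fork-grown k) z∈)
      y-in : In A y
      y-in = in-step A (in-l (here refl)) (deleteEdge⁺ {R = graph (restrict l′)} (restrict⁺ {l′} {a} {y} (ay , there (here refl) , here refl) , λ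
        { (inj₁ (refl , _)) → unique-head∉ (fork-unique k) (fork-w∈ k) ; (inj₂ (refl , _)) → fork-y∉ k (here refl) }))

    fork-a≢v : ∀ {a xs} → Fork y w ps (a ∷ xs) → a ≢ v
    fork-a≢v {xs = xs} k refl = unique-head∉ (fork-unique k) (∈-++⁺ʳ xs (there (fork-v∈ps k)))

    -- `y` is on the boundary, but not alone: being non-cut, it does not separate `v` from `z`. So
    -- the boundary consists of `y` and a second non-cut vertex, which by `fork-closed` is attached
    -- to the head.
    fork-extend : ∀ {a xs} → Fork y w ps (a ∷ xs) → ∀ {z} → z ∉ y ∷ (a ∷ xs) ++ w ∷ ps → Σ[ x ∈ Fin n ] Fork y w ps (x ∷ a ∷ xs)
    fork-extend {a} {xs} k {z} z∉ with classify-list (fork-grown k) (z∉ ∘ there)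
    ... | x₁ , x₂ , (_ , _ , sep) , b₁ , b₂ , only = go sep
      where
      l = (a ∷ xs) ++ w ∷ ps
      y-nonCut = fork-nonCuts k (here refl)
      yb : ListBoundary l y
      yb = fork-y∉ k , w , there (fork-w∈ k) , fork-wy k
      not-only-y : ¬ (∀ {t} → ListBoundary l t → t ≡ y)
      not-only-y h with exit (_∈? l) (y-nonCut v z (λ { refl → fork-y∉ k (v∈grown (fork-grown k)) }) (λ { refl → z∉ (here refl) }))
        (v∈grown (fork-grown k)) (z∉ ∘ there)
      ... | s , t , s∈ , t∉ , e = let (e′ , _ , t≢y) = delete⁻ {R = G} e in t≢y (h (t∉ , s , s∈ , e′))
      extend : ∀ {x} → ListBoundary l x → x ≢ y → NonCut G x → (∀ {t} → ListBoundary l t → t ≡ x ⊎ t ≡ y) → Fork y w ps (x ∷ a ∷ xs)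
      extend (x∉ , s , here refl , e) x≢y nc only′ = next k x∉ x≢y e
        (λ {t} t∉ f → [ id , (λ { refl → ⊥-elim (fork-no-chord k z∉ f) }) ]′ (only′ (t∉ , a , here refl , f))) nc
      extend (x∉ , s , there s∈ , e) x≢y nc only′ = ⊥-elim ([ x∉ , x≢y ∘ proj₁ ]′ (fork-closed k s∈ e))
      go : x₁ ≡ x₂ ⊎ (NonCut G x₁ × NonCut G x₂) → Σ[ x ∈ Fin n ] Fork y w ps (x ∷ a ∷ xs)
      go s with x₁ Finₚ.≟ x₂
      go s | yes refl = ⊥-elim (not-only-y λ b → trans (both (only b)) (sym (both (only yb))))
        where
        both : ∀ {t} → t ≡ x₁ ⊎ t ≡ x₁ → t ≡ x₁
        both = [ id , id ]′
      go (inj₁ eq) | no x₁≢x₂ = ⊥-elim (x₁≢x₂ eq)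
      go (inj₂ (nc₁ , nc₂)) | no x₁≢x₂ with only yb
      ... | inj₁ y≡x₁ = x₂ , extend b₂ (λ eq → x₁≢x₂ (trans (sym y≡x₁) (sym eq))) nc₂
        (λ b → [ (λ eq → inj₂ (trans eq (sym y≡x₁))) , inj₁ ]′ (only b))
      ... | inj₂ y≡x₂ = x₁ , extend b₁ (λ eq → x₁≢x₂ (trans eq y≡x₂)) nc₁
        (λ b → [ inj₁ , (λ eq → inj₂ (trans eq (sym y≡x₂))) ]′ (only b))

    -- Once all vertices are visited, a head not adjacent to `y` would have all its neighbours on
    -- the induced path and would be a second pendant vertex.
    fork-close : ∀ {a xs} → Fork y w ps (a ∷ xs) → (∀ z → z ∈ y ∷ (a ∷ xs) ++ w ∷ ps) → T (G a y)
    fork-close {a} {xs} k all = decidable-stable (Boolₚ.T? (G a y)) λ ¬ay → fork-a≢v k (only-v (pend ¬ay k))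
      where
      nbrs : ¬ T (G a y) → ∀ {z} → T (G a z) → z ∈ xs ++ w ∷ ps
      nbrs ¬ay {z} e with all z
      ... | here refl         = ⊥-elim (¬ay e)
      ... | there (here refl) = ⊥-elim (irr _ e)
      ... | there (there z∈)  = z∈
      pend : ¬ T (G a y) → Fork y w ps (a ∷ xs) → Pendant G a
      pend ¬ay (fork _ _ _ _ _ _ _ _ _) = linear-pendant (fork-linear k) (nbrs ¬ay)
      pend ¬ay (next _ _ _ _ _ _)       = linear-pendant (fork-linear k) (nbrs ¬ay)

  record Lollipop : Set where
    field
      y w a    : Fin n
      xs ps    : List (Fin n)
      tail     : Fork y w ps (a ∷ xs)
      closing  : T (G a y)
      covering : ∀ z → z ∈ y ∷ (a ∷ xs) ++ w ∷ ps

  missing⇒length< : ∀ {l : List (Fin n)} → Unique l → ∀ {z} → z ∉ l → length l < n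
  missing⇒length< {l} u {z} z∉ = subst (suc (length l) ≤_) (length-allFin n) (unique-⊆⇒length≤ {ys = allFin n} (unique-∷ z∉ u) (λ _ → ∈-allFin _))

  -- `m` bounds the number of vertices still to be visited, which makes the recursion terminate.
  follow-fork : ∀ m {y w ps a xs} → Fork y w ps (a ∷ xs) → n ≤ length ((a ∷ xs) ++ w ∷ ps) + m → Lollipop
  follow-fork m {y} {w} {ps} {a} {xs} k len with Finₚ.all? (_∈? (y ∷ (a ∷ xs) ++ w ∷ ps))
  ... | yes all = record { tail = k ; closing = fork-close k all ; covering = all }
  follow-fork zero {y} {w} {ps} {a} {xs} k len | no ¬all =
    ⊥-elim (ℕₚ.<⇒≱ (missing⇒length< (fork-unique k) (fork-y∉ k)) (subst (n ≤_) (ℕₚ.+-identityʳ _) len))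
  follow-fork (suc m) {y} {w} {ps} {a} {xs} k len | no ¬all =
    let (z , z∉ , _) = Finₚ.¬∀⟶∃¬-smallest n (_∈ y ∷ (a ∷ xs) ++ w ∷ ps) (_∈? (y ∷ (a ∷ xs) ++ w ∷ ps)) ¬all
        (x , k′) = fork-extend k z∉
    in follow-fork m k′ (subst (n ≤_) (ℕₚ.+-suc _ m) len)

  chain-extend : ∀ {h us} → Chain (h ∷ us) →
    (Σ[ x ∈ Fin n ] Chain (x ∷ h ∷ us)) ⊎ (Σ[ x ∈ Fin n ] Σ[ y ∈ Fin n ] Fork y h us (x ∷ []))
  chain-extend {h} {us} c with classify-list (chain-grown c) (proj₂ (chain-missing c))
  ... | x , y , (_ , _ , sep) , bx , by , only = go sep
    where
    from-h : ∀ {z} → ListBoundary (h ∷ us) z → T (G h z)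
    from-h (z∉ , s , here refl , e) = e
    from-h (z∉ , s , there s∈ , e)  = ⊥-elim (z∉ (chain-closed c s∈ e))
    go : x ≡ y ⊎ (NonCut G x × NonCut G y) → _
    go s with x Finₚ.≟ y
    go s | yes refl = inj₁ (x , next c (proj₁ bx) (from-h bx) λ z∉ e → [ id , id ]′ (only (z∉ , h , here refl , e)))
    go (inj₁ eq) | no x≢y = ⊥-elim (x≢y eq)
    go (inj₂ (ncx , ncy)) | no x≢y = inj₂ (x , y , fork c (proj₁ bx) (proj₁ by) x≢y (from-h bx) (from-h by)
      (λ z∉ e → only (z∉ , h , here refl , e)) ncx ncy)

  follow-chain : ∀ m {h us} → Chain (h ∷ us) → n ≤ length (h ∷ us) + m → Lollipop
  follow-chain zero {h} {us} c len =
    ⊥-elim (ℕₚ.<⇒≱ (missing⇒length< (chain-unique c) (proj₂ (chain-missing c))) (subst (n ≤_) (ℕₚ.+-identityʳ _) len))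
  follow-chain (suc m) c len with chain-extend c
  ... | inj₁ (x , c′)     = follow-chain m c′ (subst (n ≤_) (ℕₚ.+-suc _ m) len)
  ... | inj₂ (x , y , k) = follow-fork m k (subst (n ≤_) (ℕₚ.+-suc _ m) len)

  abstract
    lollipop : Lollipop
    lollipop = follow-chain n start (ℕₚ.n≤1+n n)

  open Lollipop lollipop

  order : List (Fin n)
  order = y ∷ (a ∷ xs) ++ w ∷ ps

  -- The cycle consists of `y`, `a ∷ xs` and `w`. In `order`, `y` has position 0 and `w` has
  -- position `cycleLength ∸ 1`, the ends of the extra edge of `L`.
  cycleLength : ℕ
  cycleLength = suc (suc (length (a ∷ xs)))

  unique-order : Unique order
  unique-order = unique-∷ (fork-y∉ tail) (fork-unique tail)

  length-order : length order ≡ n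
  length-order = ℕₚ.≤-antisym
    (subst (length order ≤_) (length-allFin n) (unique-⊆⇒length≤ {ys = allFin n} unique-order (λ _ → ∈-allFin _)))
    (subst (_≤ length order) (length-allFin n) (unique-⊆⇒length≤ (Uniqueₚ.allFin⁺ n) (λ _ → covering _)))

  adjacent⁺ : ∀ {i j s t} → At order i s → At order j t → LEdge cycleLength i j → T (G t s)
  adjacent⁺ hd     (tl hd) (inj₁ refl) = closing
  adjacent⁺ (tl p) (tl q)  (inj₁ refl) = linear-edge (fork-linear tail) p q
  adjacent⁺ hd     (tl q)  (inj₂ (refl , refl)) with refl ← at-element q (at-++ (a ∷ xs)) = fork-wy tail

  adjacent⁻ : ∀ {i j s t} → At order i s → At order j t → i < j → T (G t s) → LEdge cycleLength i j
  adjacent⁻ hd     (tl hd)     _        e = inj₁ refl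
  adjacent⁻ hd     (tl (tl q)) _        e with fork-closed tail (at-∈ q) e
  ... | inj₁ y∈         = ⊥-elim (fork-y∉ tail y∈)
  ... | inj₂ (_ , refl) = inj₂ (refl , cong suc (at-position (fork-unique tail) (tl q) (at-++ (a ∷ xs))))
  adjacent⁻ (tl p) (tl q)      (s≤s lt) e = inj₁ (cong suc (linear-adjacent (fork-linear tail) lt p q e))

  position : Fin n → Fin n
  position z = Fin.cast length-order (index (covering z))

  at-position-of : ∀ z → At order (toℕ (position z)) z
  at-position-of z = subst (λ i → At order i z) (sym (Finₚ.toℕ-cast length-order (index (covering z)))) (at-index (covering z))

  vertex : Fin n → Fin n
  vertex i = lookup order (Fin.cast (sym length-order) i)

  vertex∘position : ∀ z → vertex (position z) ≡ z
  vertex∘position z = trans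
    (cong (lookup order) (Finₚ.toℕ-injective (trans (Finₚ.toℕ-cast (sym length-order) (position z)) (Finₚ.toℕ-cast length-order (index (covering z))))))
    (sym (lookup-index (covering z)))

  at-lookup : ∀ (l : List (Fin n)) i → At l (toℕ i) (lookup l i)
  at-lookup (x ∷ l) zero    = hd
  at-lookup (x ∷ l) (suc i) = tl (at-lookup l i)

  position∘vertex : ∀ i → position (vertex i) ≡ i
  position∘vertex i = Finₚ.toℕ-injective (trans (at-position unique-order (at-position-of (vertex i)) (at-lookup order (Fin.cast (sym length-order) i)))
    (Finₚ.toℕ-cast (sym length-order) i))

  σ : Fin n ↔ Fin n
  σ = mk↔ₛ′ position vertex position∘vertex vertex∘position

  iso : Iso G (L n cycleLength) σ
  iso s t = T⇔→≡ to from
    where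
    p = at-position-of s
    q = at-position-of t
    to : T (G s t) → T (L n cycleLength (position s) (position t))
    to e with ℕₚ.<-cmp (toℕ (position s)) (toℕ (position t))
    ... | tri< lt ne _ = L⁺ cycleLength _ _ ne (inj₁ (adjacent⁻ p q lt (swap sG e)))
    ... | tri> _ ne gt = L⁺ cycleLength _ _ ne (inj₂ (adjacent⁻ q p gt e))
    ... | tri≈ _ eq _  with refl ← at-element p (subst (λ i → At order i t) (sym eq) q) = ⊥-elim (irr _ e)
    from : T (L n cycleLength (position s) (position t)) → T (G s t)
    from e with L⁻ cycleLength (position s) (position t) e
    ... | inj₁ h = swap sG (adjacent⁺ p q h)
    ... | inj₂ h = adjacent⁺ q p h

  σ-v : toℕ (Inverse.to σ v) ≡ n ∸ 1
  σ-v = let (i , eq , p) = fork-last tail in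
    trans (at-position unique-order (at-position-of v) (tl p)) (trans eq (cong (_∸ 1) length-order))

  -- The cycle without `w`, with `v` in its place; `v` lies in the tail `ps` and is therefore new.
  cycle-nonCuts : Σ[ zs ∈ List (Fin n) ] (Unique zs × length zs ≡ cycleLength × (∀ {z} → z ∈ zs → NonCut G z))
  cycle-nonCuts = v ∷ y ∷ a ∷ xs , unique-∷ v∉ (prefix (y ∷ a ∷ xs) unique-order) , refl , λ
    { (here refl) → pendant⇒nonCut sG conn v-pendant ; (there z∈) → fork-nonCuts tail z∈ }
    where
    v∉ : v ∉ y ∷ a ∷ xs
    v∉ v∈ = disjoint (y ∷ a ∷ xs) unique-order v∈ (there (fork-v∈ps tail))
      where
      disjoint : ∀ (us : List (Fin n)) {us′} → Unique (us ++ us′) → ∀ {z} → z ∈ us → z ∈ us′ → ⊥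
      disjoint (x ∷ us) u       (here refl) z∈′ = unique-head∉ u (∈-++⁺ʳ us z∈′)
      disjoint (x ∷ us) (_ ∷ u) (there z∈)  z∈′ = disjoint us u z∈ z∈′
    prefix : ∀ (us : List (Fin n)) {us′} → Unique (us ++ us′) → Unique us
    prefix []       _ = []
    prefix (x ∷ us) u@(_ ∷ u′) = unique-∷ (unique-head∉ u ∘ ∈-++⁺ˡ) (prefix us u′)

-- Connected subgraphs of L n c containing the pendant vertex

-- The lowest vertex reached from `m` by present path edges going down.
run-down : (ℕ → Bool) → ℕ → ℕ
run-down p zero    = zero
run-down p (suc i) = if p i then run-down p i else suc i

run-down≤ : ∀ p m → run-down p m ≤ m
run-down≤ p zero = z≤n
run-down≤ p (suc m) with p m
... | true  = ℕₚ.m≤n⇒m≤1+n (run-down≤ p m)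
... | false = ℕₚ.≤-refl

run-down-true : ∀ p m {i} → run-down p m ≤ i → i < m → T (p i)
run-down-true p (suc m) {i} le lt with p m in eq
... | false = ⊥-elim (ℕₚ.<⇒≱ lt le)
... | true with ℕₚ.m≤n⇒m<n∨m≡n (ℕₚ.≤-pred lt)
...   | inj₁ i<m  = run-down-true p m le i<m
...   | inj₂ refl = T-subst (sym eq) tt

run-down-false : ∀ p m {i} → run-down p m ≡ suc i → ¬ T (p i)
run-down-false p (suc m) eq t with p m in e
... | true  = run-down-false p m eq t
... | false with refl ← eq = T-subst e t

run-up : (ℕ → Bool) → ℕ → ℕ
run-up p zero    = zero
run-up p (suc f) = if p 0 then suc (run-up (p ∘ suc) f) else 0

run-up≤ : ∀ p f → run-up p f ≤ f
run-up≤ p zero = z≤n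
run-up≤ p (suc f) with p 0
... | true  = s≤s (run-up≤ (p ∘ suc) f)
... | false = z≤n

run-up-true : ∀ p f {i} → i < run-up p f → T (p i)
run-up-true p (suc f) {i} lt with p 0 in eq
run-up-true p (suc f) {zero}  lt       | true = T-subst (sym eq) tt
run-up-true p (suc f) {suc i} (s≤s lt) | true = run-up-true (p ∘ suc) f lt

run-up-false : ∀ (p : ℕ → Bool) f → ¬ T (p f) → ¬ T (p (run-up p f))
run-up-false p zero    h = h
run-up-false p (suc f) h with p 0 in eq
... | true  = run-up-false (p ∘ suc) f h
... | false = T-subst eq

-- How many of the vertices `0, …, u` are reached through the chord; zero stands for an absent
-- chord, so that the number also records `q`.
through-chord : Bool → ℕ → ℕ
through-chord q u = if q then suc u else 0

chord⇒0<through : ∀ {q u} → T q → 0 < through-chord q u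
chord⇒0<through {true} _ = s≤s z≤n

0<through⇒chord : ∀ {q u} → 0 < through-chord q u → T q
0<through⇒chord {true} _ = tt

<through⇒≤ : ∀ {q u i} → i < through-chord q u → i ≤ u
<through⇒≤ {true} lt = ℕₚ.≤-pred lt

<through-suc : ∀ {q u i} → i < through-chord q u → i < u → suc i < through-chord q u
<through-suc {true} _ lt = s≤s lt

through≤ : ∀ {q u} → through-chord q u ≤ suc u
through≤ {true}  = ℕₚ.≤-refl
through≤ {false} = z≤n

through≡0 : ∀ {q u} → ¬ T q → through-chord q u ≡ 0
through≡0 {false} _ = refl
through≡0 {true}  h = ⊥-elim (h tt)

-- Edges i ~ i+1 (present when p i) of the path 0, …, m together with an edge 0 ~ d (present when q):
-- every edge present can be reached from the vertex m.
Anchored : ℕ → ℕ → (ℕ → Bool) → Bool → Set₁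
Anchored m d p q = (Q : ℕ → Set) → Q m →
  (∀ {i} → i < m → T (p i) → Q i → Q (suc i)) → (∀ {i} → i < m → T (p i) → Q (suc i) → Q i) →
  (T q → Q 0 → Q d) → (T q → Q d → Q 0) →
  (∀ {i} → i < m → T (p i) → Q i) × (T q → Q 0)

module Ends (m d : ℕ) (p : ℕ → Bool) (q : Bool) (anchored : Anchored m d p q) where

  a u b : ℕ
  a = run-down p m
  -- If `a` is positive, the edge below it is missing, so the upward run stops at `a ∸ 1` at the
  -- latest.
  u = run-up p (a ∸ 1)
  b = through-chord q u

  a-false : ∀ {i} → a ≡ suc i → ¬ T (p i)
  a-false = run-down-false p m

  u-false : 0 < a → ¬ T (p u)
  u-false lt = run-up-false p (a ∸ 1) (a-false (sym (ℕₚ.suc-pred a ⦃ >-nonZero lt ⦄)))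

  a-lower : ∀ {i} → T (p i) → a ≤ suc i → a ≤ i
  a-lower t le with ℕₚ.m≤n⇒m<n∨m≡n le
  ... | inj₁ lt = ℕₚ.≤-pred lt
  ... | inj₂ eq = ⊥-elim (a-false eq t)

  -- If `d < a`, the vertices from `a` upwards are closed under the present edges. The chord could
  -- then not be reached from `m`.
  q⇒a≤d : T q → a ≤ d
  q⇒a≤d t with a ℕₚ.≤? d
  ... | yes le = le
  ... | no ¬le = ⊥-elim (¬le (ℕₚ.≤-trans (proj₂ (anchored (a ≤_) (run-down≤ p m) (λ _ _ → ℕₚ.m≤n⇒m≤1+n) (λ _ → a-lower)
      (λ _ le → ℕₚ.≤-trans le z≤n) (λ _ le → ⊥-elim (¬le le))) t) z≤n))

  -- The vertices from `a` upwards, together with the run reached through the chord, are closed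
  -- under the present edges. Every present edge therefore lies in one of the two runs, and `a` and
  -- `b` determine all path edges.
  p⇒ : ∀ {i} → i < m → T (p i) → a ≤ i ⊎ suc i < b
  p⇒ {i} lt t with a ℕₚ.≤? i
  ... | yes le = inj₁ le
  ... | no ¬le = [ inj₁ , (λ i<b → inj₂ (up t i<b)) ]′ (proj₁ (anchored Q (inj₁ (run-down≤ p m))
        (λ _ t → [ inj₁ ∘ ℕₚ.m≤n⇒m≤1+n , inj₂ ∘ up t ]′)
        (λ _ t → [ inj₁ ∘ a-lower t , inj₂ ∘ ℕₚ.<-trans (ℕₚ.n<1+n _) ]′)
        (λ t _ → inj₁ (q⇒a≤d t)) (λ t _ → inj₂ (chord⇒0<through t))) lt t)
    where
    Q : ℕ → Set
    Q j = a ≤ j ⊎ j < b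
    up : ∀ {j} → T (p j) → j < b → suc j < b
    up {j} t j<b with ℕₚ.m≤n⇒m<n∨m≡n (<through⇒≤ {q} j<b)
    ... | inj₂ refl = ⊥-elim (u-false (ℕₚ.≤-trans (s≤s z≤n) (ℕₚ.≰⇒> ¬le)) t)
    ... | inj₁ j<u = <through-suc {q} j<b j<u

  p⇐ : ∀ {i} → i < m → a ≤ i ⊎ suc i < b → T (p i)
  p⇐ lt (inj₁ le)  = run-down-true p m le lt
  p⇐ lt (inj₂ i<b) = run-up-true p (a ∸ 1) (<through⇒≤ {q} i<b)

  b≤1 : a ≡ 0 → b ≤ 1
  b≤1 eq = ℕₚ.≤-trans (through≤ {q}) (s≤s (ℕₚ.≤-trans (run-up≤ p (a ∸ 1)) (ℕₚ.≤-reflexive (cong (_∸ 1) eq))))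

  b≤a : 0 < a → b ≤ a
  b≤a lt = ℕₚ.≤-trans (through≤ {q}) (ℕₚ.≤-trans (s≤s (run-up≤ p (a ∸ 1))) (ℕₚ.≤-reflexive (ℕₚ.suc-pred a ⦃ >-nonZero lt ⦄)))

  b≡0 : d < a → b ≡ 0
  b≡0 lt = through≡0 {q} λ t → ℕₚ.<⇒≱ lt (q⇒a≤d t)

length-map-upTo-++ : ∀ {A : Set} (f : ℕ → A) k ys → length (map f (upTo k) ++ ys) ≡ k + length ys
length-map-upTo-++ f k ys = trans (Listₚ.length-++ (map f (upTo k)))
  (cong (_+ length ys) (trans (Listₚ.length-map f (upTo k)) (Listₚ.length-upTo k)))

triangle : ℕ → List (ℕ × ℕ)
triangle zero    = (0 , 0) ∷ []
triangle (suc a) = map (suc a ,_) (upTo (suc (suc a))) ++ triangle a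

∈-triangle : ∀ d {a b} → a ≤ d → b ≤ a → (a , b) ∈ triangle d
∈-triangle zero    z≤n z≤n = here refl
∈-triangle (suc d) {a} le le′ with ℕₚ.m≤n⇒m<n∨m≡n le
... | inj₁ (s≤s lt) = ∈-++⁺ʳ (map (suc d ,_) (upTo (suc (suc d)))) (∈-triangle d lt le′)
... | inj₂ refl     = ∈-++⁺ˡ (∈-map⁺ (suc d ,_) (∈-upTo⁺ (s≤s le′)))

length-triangle : ∀ d → 2 * length (triangle d) ≡ suc d * suc (suc d)
length-triangle zero    = refl
length-triangle (suc d) = trans (cong (2 *_) (length-map-upTo-++ (λ b → suc d , b) (suc (suc d)) (triangle d)))
  (trans (ℕₚ.*-distribˡ-+ 2 (suc (suc d)) (length (triangle d)))
    (trans (cong (2 * suc (suc d) +_) (length-triangle d)) (arith d)))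
  where
  arith : ∀ d → 2 * suc (suc d) + suc d * suc (suc d) ≡ suc (suc d) * suc (suc (suc d))
  arith = solve 1 (λ d → con 2 :* (con 2 :+ d) :+ (con 1 :+ d) :* (con 2 :+ d) := (con 2 :+ d) :* (con 3 :+ d)) refl

-- The possible pairs `a , b`: `(0 , 1)` is the full path with the chord; for `a > d` the chord is
-- out of reach and `b` is 0; the triangle holds the pairs with `b ≤ a ≤ d`.
codes : ℕ → ℕ → List (ℕ × ℕ)
codes m d = (0 , 1) ∷ map (λ i → suc d + i , 0) (upTo (m ∸ d)) ++ triangle d

length-codes : ∀ m d → 2 * length (codes m d) ≡ 2 + 2 * (m ∸ d) + suc d * suc (suc d)
length-codes m d = trans (cong (λ l → 2 * suc l) (length-map-upTo-++ (λ i → suc d + i , 0) (m ∸ d) (triangle d)))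
  (trans (arith (m ∸ d) (length (triangle d))) (cong (2 + 2 * (m ∸ d) +_) (length-triangle d)))
  where
  arith : ∀ x t → 2 * suc (x + t) ≡ 2 + 2 * x + 2 * t
  arith = solve 2 (λ x t → con 2 :* (con 1 :+ (x :+ t)) := con 2 :+ con 2 :* x :+ con 2 :* t) refl

module PendantCount {m : ℕ} (G : Graph (suc m)) (v : Fin (suc m)) (d : ℕ)
  (σ : Fin (suc m) ↔ Fin (suc m)) (iso : Iso G (L (suc m) (suc d)) σ) (σv : toℕ (Inverse.to σ v) ≡ m) where

  pos : Fin (suc m) → ℕ
  pos x = toℕ (Inverse.to σ x)

  pos≤ : ∀ x → pos x ≤ m
  pos≤ x = ℕₚ.≤-pred (Finₚ.toℕ<n (Inverse.to σ x))

  vert : ℕ → Fin (suc m)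
  vert i with i ℕₚ.≤? m
  ... | yes le = Inverse.from σ (Fin.fromℕ< (s≤s le))
  ... | no _   = v

  pos-vert : ∀ {i} → i ≤ m → pos (vert i) ≡ i
  pos-vert {i} le with i ℕₚ.≤? m
  ... | yes le′ = trans (cong toℕ (Inverse.strictlyInverseˡ σ _)) (Finₚ.toℕ-fromℕ< (s≤s le′))
  ... | no ¬le  = ⊥-elim (¬le le)

  pos-injective : ∀ {x y} → pos x ≡ pos y → x ≡ y
  pos-injective {x} {y} eq = trans (sym (Inverse.strictlyInverseʳ σ x))
    (trans (cong (Inverse.from σ) (Finₚ.toℕ-injective eq)) (Inverse.strictlyInverseʳ σ y))

  vert-pos : ∀ {x i} → pos x ≡ i → vert i ≡ x
  vert-pos {x} refl = pos-injective (pos-vert (pos≤ x))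

  edge : Vec (Vec Bool (suc m)) (suc m) → Fin (suc m) → Fin (suc m) → Bool
  edge E i j = Vec.lookup (Vec.lookup E i) j

  path : Vec (Vec Bool (suc m)) (suc m) → ℕ → Bool
  path E i = edge E (vert i) (vert (suc i))

  chord : Vec (Vec Bool (suc m)) (suc m) → Bool
  chord E = edge E (vert 0) (vert d)

  record Valid (S : Vec Bool (suc m)) (E : Vec (Vec Bool (suc m)) (suc m)) : Set where
    field
      v∈   : T (Vec.lookup S v)
      isG  : ∀ i j → T (edge E i j) → T (G i j ∧ Vec.lookup S i ∧ Vec.lookup S j)
      Esym : ∀ i j → edge E i j ≡ edge E j i
      walk : ∀ u w → T (Vec.lookup S u) → T (Vec.lookup S w) → Walk (edge E) u w

  -- The properties are irrelevant in `ConnSub`; each of them is decidable and can therefore be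
  -- recovered.
  valid : (X : ConnSub G v) → Valid (ConnSub.S X) (ConnSub.E X)
  valid (connSub S E vIn Esub Esym conn) = record
    { v∈   = recompute (Boolₚ.T? _) vIn
    ; isG  = λ i j t → recompute (Boolₚ.T? _) (Esub i j t)
    ; Esym = λ i j → recompute (_ Boolₚ.≟ _) (Esym i j)
    ; walk = λ u w p q → recompute (walk? (edge E) u w) (conn u w p q)
    }

  module _ {S E} (V : Valid S E) where
    open Valid V

    ends : ∀ {i j} → T (edge E i j) → T (Vec.lookup S i) × T (Vec.lookup S j)
    ends {i} {j} t = T-∧⁻ {Vec.lookup S i} (proj₂ (T-∧⁻ {G i j} (isG i j t)))

    data EdgeShape (x y : Fin (suc m)) : Set where
      up    : suc (pos x) ≡ pos y → T (path E (pos x)) → EdgeShape x y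
      down  : suc (pos y) ≡ pos x → T (path E (pos y)) → EdgeShape x y
      cross : pos x ≡ 0 → pos y ≡ d → T (chord E) → EdgeShape x y
      back  : pos x ≡ d → pos y ≡ 0 → T (chord E) → EdgeShape x y

    edge-at : ∀ {x y i j} → pos x ≡ i → pos y ≡ j → T (edge E x y) → T (edge E (vert i) (vert j))
    edge-at p q = subst₂ (λ a b → T (edge E a b)) (sym (vert-pos p)) (sym (vert-pos q))

    shape : ∀ {x y} → T (edge E x y) → EdgeShape x y
    shape {x} {y} t with L⁻ (suc d) _ _ (T-subst (iso x y) (proj₁ (T-∧⁻ {G x y} (isG x y t))))
    ... | inj₁ (inj₁ eq)      = up eq (edge-at refl (sym eq) t)
    ... | inj₁ (inj₂ (p , q)) = cross p q (edge-at p q t)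
    ... | inj₂ (inj₁ eq)      = down eq (edge-at refl (sym eq) (T-subst (Esym x y) t))
    ... | inj₂ (inj₂ (p , q)) = back q p (edge-at p q (T-subst (Esym x y) t))

    -- Induction along a walk inside the subgraph from `v`, which has position `m`.
    spread : (Q : ℕ → Set) → Q m →
      (∀ {i} → i < m → T (path E i) → Q i → Q (suc i)) → (∀ {i} → i < m → T (path E i) → Q (suc i) → Q i) →
      (T (chord E) → Q 0 → Q d) → (T (chord E) → Q d → Q 0) → ∀ {z} → T (Vec.lookup S z) → Q (pos z)
    spread Q Qm f g h k {z} z∈ = go (walk v z v∈ z∈) (subst Q (sym σv) Qm)
      where
      across : ∀ {x y} → EdgeShape x y → Q (pos x) → Q (pos y)
      across {x} {y} (up eq t)     q = subst Q eq (f (subst (_≤ m) (sym eq) (pos≤ y)) t q)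
      across {x} {y} (down eq t)   q = g (subst (_≤ m) (sym eq) (pos≤ x)) t (subst Q (sym eq) q)
      across         (cross p r t) q = subst Q (sym r) (h t (subst Q p q))
      across         (back p r t)  q = subst Q (sym r) (k t (subst Q p q))
      go : ∀ {x} → Walk (edge E) x z → Q (pos x) → Q (pos z)
      go here       q = q
      go (step e w) q = go w (across (shape e) q)

    anchored : Anchored m d (path E) (chord E)
    anchored Q Qm f g h k =
      (λ {i} lt t → subst Q (pos-vert (ℕₚ.<⇒≤ lt)) (spread Q Qm f g h k (proj₁ (ends t)))) ,
      (λ t → subst Q (pos-vert z≤n) (spread Q Qm f g h k (proj₁ (ends t))))

  code : ∀ {S E} → Valid S E → ℕ × ℕ
  code {E = E} V = Ends.a m d (path E) (chord E) (anchored V) , Ends.b m d (path E) (chord E) (anchored V)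

  code∈ : ∀ {S E} (V : Valid S E) → code V ∈ codes m d
  code∈ {E = E} V = go refl refl
    where
    open Ends m d (path E) (chord E) (anchored V)
    go : ∀ {a′ b′} → a ≡ a′ → b ≡ b′ → (a′ , b′) ∈ codes m d
    go {a′} {b′} ea eb with a′ ℕₚ.≤? d
    go {zero} {zero}        ea eb | yes le = there (∈-++⁺ʳ (map (λ i → suc d + i , 0) (upTo (m ∸ d))) (∈-triangle d z≤n z≤n))
    go {zero} {suc zero}    ea eb | yes le = here refl
    go {zero} {suc (suc _)} ea eb | yes le = ⊥-elim (ℕₚ.<⇒≱ (s≤s (s≤s z≤n)) (subst (_≤ 1) eb (b≤1 ea)))
    go {suc a′} {b′}        ea eb | yes le = there (∈-++⁺ʳ (map (λ i → suc d + i , 0) (upTo (m ∸ d)))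
      (∈-triangle d le (subst₂ _≤_ eb ea (b≤a (subst (0 <_) (sym ea) (s≤s z≤n))))))
    go {a′} {b′} ea eb | no ¬le with refl ← trans (sym eb) (b≡0 (subst (d <_) (sym ea) (ℕₚ.≰⇒> ¬le))) =
      there (∈-++⁺ˡ (subst (λ k → (k , 0) ∈ map (λ i → suc d + i , 0) (upTo (m ∸ d)))
        (ℕₚ.m+[n∸m]≡n (ℕₚ.≰⇒> ¬le))
        (∈-map⁺ (λ i → suc d + i , 0) (∈-upTo⁺ (ℕₚ.∸-monoˡ-< (s≤s (subst (_≤ m) ea (run-down≤ (path E) m))) (ℕₚ.≰⇒> ¬le))))))

  same-edges : ∀ {S E S′ E′} (V : Valid S E) (V′ : Valid S′ E′) → code V ≡ code V′ → ∀ {x y} → T (edge E x y) → T (edge E′ x y)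
  same-edges {E = E} {E′ = E′} V V′ eq {x} {y} t = go (shape V t)
    where
    module A = Ends m d (path E) (chord E) (anchored V)
    module B = Ends m d (path E′) (chord E′) (anchored V′)
    path⇒ : ∀ {i} → i < m → T (path E i) → T (path E′ i)
    path⇒ {i} lt t = B.p⇐ lt (subst₂ (λ a b → a ≤ i ⊎ suc i < b) (cong proj₁ eq) (cong proj₂ eq) (A.p⇒ lt t))
    chord⇒ : T (chord E) → T (chord E′)
    chord⇒ t = 0<through⇒chord {chord E′} {B.u} (subst (0 <_) (cong proj₂ eq) (chord⇒0<through t))
    back-at : ∀ {x y i j} → pos x ≡ i → pos y ≡ j → T (edge E′ (vert i) (vert j)) → T (edge E′ x y)
    back-at p q = subst₂ (λ a b → T (edge E′ a b)) (vert-pos p) (vert-pos q)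
    go : EdgeShape V x y → T (edge E′ x y)
    go (up e t)      = back-at refl (sym e) (path⇒ (subst (_≤ m) (sym e) (pos≤ y)) t)
    go (down e t)    = T-subst (Valid.Esym V′ y x) (back-at refl (sym e) (path⇒ (subst (_≤ m) (sym e) (pos≤ x)) t))
    go (cross p q t) = back-at p q (chord⇒ t)
    go (back p q t)  = T-subst (Valid.Esym V′ y x) (back-at q p (chord⇒ t))

  -- The edges determine the vertices: a walk from `v` in the first subgraph is also one in the
  -- second.
  same-vertices : ∀ {S E S′ E′} (V : Valid S E) (V′ : Valid S′ E′) → (∀ {x y} → T (edge E x y) → T (edge E′ x y)) →
    ∀ {z} → T (Vec.lookup S z) → T (Vec.lookup S′ z)
  same-vertices V V′ f {z} z∈ = go (Valid.walk V v z (Valid.v∈ V) z∈) (Valid.v∈ V′)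
    where
    go : ∀ {x} → Walk _ x z → _ → _
    go here       p = p
    go (step e w) p = go w (proj₂ (ends V′ (f e)))

  lookup-ext : ∀ {A : Set} {k} {xs ys : Vec A k} → (∀ i → Vec.lookup xs i ≡ Vec.lookup ys i) → xs ≡ ys
  lookup-ext {xs = xs} {ys} h = trans (sym (Vecₚ.tabulate∘lookup xs)) (trans (Vecₚ.tabulate-cong h) (Vecₚ.tabulate∘lookup ys))

  code-injective : ∀ X Y → code (valid X) ≡ code (valid Y) → X ≡ Y
  code-injective X Y eq = same-parts X Y
    (lookup-ext λ z → T⇔→≡ (same-vertices (valid X) (valid Y) there′) (same-vertices (valid Y) (valid X) back′))
    (lookup-ext λ i → lookup-ext λ j → T⇔→≡ there′ back′)
    where
    there′ = same-edges (valid X) (valid Y) eq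
    back′  = same-edges (valid Y) (valid X) (sym eq)
    same-parts : ∀ (X Y : ConnSub G v) → ConnSub.S X ≡ ConnSub.S Y → ConnSub.E X ≡ ConnSub.E Y → X ≡ Y
    same-parts (connSub _ _ _ _ _ _) (connSub _ _ _ _ _ _) refl refl = refl

  count≤ : ∀ {N} → fCount G v N → 2 * N ≤ 2 + 2 * (m ∸ d) + suc d * suc (suc d)
  count≤ {N} count = subst (2 * N ≤_) (length-codes m d) (ℕₚ.*-monoʳ-≤ 2
    (subst (_≤ length (codes m d)) (trans (Listₚ.length-map f (allFin N)) (length-allFin N))
      (unique-⊆⇒length≤ (unique-map {f = f} (λ _ _ → f-injective) (Uniqueₚ.allFin⁺ N)) f∈)))
    where
    f : Fin N → ℕ × ℕ
    f i = code (valid (Inverse.to count i))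
    f∈ : ∀ {k} → k ∈ map f (allFin N) → k ∈ codes m d
    f∈ k∈ = let (i , _ , eq) = ∈-map⁻ f k∈ in subst (_∈ codes m d) (sym eq) (code∈ (valid (Inverse.to count i)))
    f-injective : ∀ {i j} → f i ≡ f j → i ≡ j
    f-injective {i} {j} eq = trans (sym (Inverse.strictlyInverseʳ count i))
      (trans (cong (Inverse.from count) (code-injective _ _ eq)) (Inverse.strictlyInverseʳ count j))

lollipop-count≤ : ∀ {n} (G : Graph n) v c (σ : Fin n ↔ Fin n) → 1 ≤ c → Iso G (L n c) σ → toℕ (Inverse.to σ v) ≡ n ∸ 1 →
  ∀ {N} → fCount G v N → 2 * N ≤ 2 + 2 * (n ∸ c) + c * suc c
lollipop-count≤ {suc m} G v (suc d) σ _ iso σv = PendantCount.count≤ G v d σ iso σv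

-- The number of cut vertices and the choice of `r`

module CutVertices {n : ℕ} (G : Graph n) {k : ℕ} (cutCount : NumCutVertices G k) where

  cutVertex : Fin k → Fin n
  cutVertex i = CutVertex.vertex (Inverse.to cutCount i)

  isCut : (x : CutVertex G) → ¬ NonCut G (CutVertex.vertex x)
  isCut (cutV x cut) = recompute (¬? (nonCut? G x)) cut

  cutVertex-injective : ∀ {i j} → cutVertex i ≡ cutVertex j → i ≡ j
  cutVertex-injective {i} {j} eq = trans (sym (Inverse.strictlyInverseʳ cutCount i))
    (trans (cong (Inverse.from cutCount) (same (Inverse.to cutCount i) (Inverse.to cutCount j) eq)) (Inverse.strictlyInverseʳ cutCount j))
    where
    same : (x y : CutVertex G) → CutVertex.vertex x ≡ CutVertex.vertex y → x ≡ y
    same (cutV _ _) (cutV _ _) refl = refl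

  length-cuts : length (filter (¬? ∘ nonCut? G) (allFin n)) ≡ k
  length-cuts = ℕₚ.≤-antisym
    (subst (length cuts ≤_) length-enum (unique-⊆⇒length≤ {ys = enum} (Uniqueₚ.filter⁺ (¬? ∘ nonCut? G) (Uniqueₚ.allFin⁺ n)) cuts⊆))
    (subst (_≤ length cuts) length-enum (unique-⊆⇒length≤ {xs = enum} (unique-map (λ _ _ → cutVertex-injective) (Uniqueₚ.allFin⁺ k)) ⊆cuts))
    where
    cuts enum : List (Fin n)
    cuts = filter (¬? ∘ nonCut? G) (allFin n)
    enum = map cutVertex (allFin k)
    length-enum : length enum ≡ k
    length-enum = trans (Listₚ.length-map cutVertex (allFin k)) (length-allFin k)
    ⊆cuts : ∀ {x} → x ∈ enum → x ∈ cuts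
    ⊆cuts x∈ with ∈-map⁻ cutVertex x∈
    ... | i , _ , refl = ∈-filter⁺ (¬? ∘ nonCut? G) (∈-allFin _) (isCut (Inverse.to cutCount i))
    cuts⊆ : ∀ {x} → x ∈ cuts → x ∈ enum
    cuts⊆ {x} x∈ = subst (_∈ enum) (cong CutVertex.vertex (Inverse.strictlyInverseˡ cutCount c)) (∈-map⁺ cutVertex (∈-allFin (Inverse.from cutCount c)))
      where
      c : CutVertex G
      c = cutV x (proj₂ (∈-filter⁻ (¬? ∘ nonCut? G) {xs = allFin n} x∈))

  good-cut : Symmetric G → (∀ i → ¬ T (G i i)) → Connected G → 1 ≤ k → ¬ IsTree G → Σ[ r ∈ Fin n ] (Good G r × ¬ NonCut G r)
  good-cut sG irr conn 1≤k ¬tree = decidable-stable (Finₚ.any? λ r → good? G r ×-dec ¬? (nonCut? G r)) λ none →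
    ¬tree (conn , λ cyc → isCut (Inverse.to cutCount (Fin.fromℕ< 1≤k))
      (nonCut none _ (all-good sG irr conn (nonCut none) (nonBridge⇒good sG irr conn (proj₂ (proj₂ (cycle⇒nonBridge sG irr conn cyc)))) _)))
    where
    nonCut : ¬ (Σ[ r ∈ Fin n ] (Good G r × ¬ NonCut G r)) → ∀ z → Good G z → NonCut G z
    nonCut none z g = decidable-stable (nonCut? G z) λ cut → none (z , g , cut)

-- Arithmetic of the bound

target : ℕ → ℕ → ℕ → ℕ
target c n k = c ^ 2 + n + k + 2

-- With c′, k′, n′ the numbers of non-cut, cut and arbitrary vertices other than v, q that of pendant vertices other than v,
-- and c₁ that of non-pendant non-cut vertices.
enumerated : (c′ k′ n′ q c₁ : ℕ) → ℕ
enumerated c′ k′ n′ q c₁ = ((c′ * c′ + (n′ + k′)) + 2) + (suc c₁ * 2 + q * 4)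

enumerated-cut : ∀ c k′ n′ q c₁ → enumerated c k′ n′ q c₁ ≡ target c (suc n′) (suc k′) + (2 * c₁ + 4 * q)
enumerated-cut = solve 5 (λ c k n q c₁ →
  (c :* c :+ (n :+ k) :+ con 2) :+ ((con 1 :+ c₁) :* con 2 :+ q :* con 4) :=
  (c :* (c :* con 1) :+ (con 1 :+ n) :+ (con 1 :+ k) :+ con 2) :+ (con 2 :* c₁ :+ con 4 :* q)) refl

-- For pendant `v` the non-cut vertices are `v`, the `q` other pendant vertices and the `c₁` inner
-- ones. The surplus `2 * q` vanishes only if no other vertex is pendant.
enumerated-pendant : ∀ k n′ q c₁ → enumerated (q + c₁) k n′ q c₁ ≡ target (suc (q + c₁)) (suc n′) k + 2 * q
enumerated-pendant = solve 4 (λ k n q c₁ →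
  ((q :+ c₁) :* (q :+ c₁) :+ (n :+ k) :+ con 2) :+ ((con 1 :+ c₁) :* con 2 :+ q :* con 4) :=
  ((con 1 :+ (q :+ c₁)) :* ((con 1 :+ (q :+ c₁)) :* con 1) :+ (con 1 :+ n) :+ k :+ con 2) :+ con 2 :* q) refl

-- Here `v` is non-cut but not pendant, so it is itself among the `c₁` vertices; this is where the
-- extra 2 comes from.
enumerated-inner : ∀ c′ k n′ q c₁ → suc c′ ≡ q + c₁ → enumerated c′ k n′ q c₁ ≡ target (suc c′) (suc n′) k + (2 + 2 * q)
enumerated-inner c′ k n′ q c₁ eq = trans (expand c′ k n′ q c₁) (trans (cong (λ s → c′ * c′ + n′ + k + 4 + 2 * s + 2 * q) (sym eq)) (collect c′ k n′ q))
  where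
  expand : ∀ c′ k n′ q c₁ → enumerated c′ k n′ q c₁ ≡ c′ * c′ + n′ + k + 4 + 2 * (q + c₁) + 2 * q
  expand = solve 5 (λ c k n q c₁ →
    (c :* c :+ (n :+ k) :+ con 2) :+ ((con 1 :+ c₁) :* con 2 :+ q :* con 4) :=
    c :* c :+ n :+ k :+ con 4 :+ con 2 :* (q :+ c₁) :+ con 2 :* q) refl
  collect : ∀ c′ k n′ q → c′ * c′ + n′ + k + 4 + 2 * suc c′ + 2 * q ≡ target (suc c′) (suc n′) k + (2 + 2 * q)
  collect = solve 4 (λ c k n q →
    c :* c :+ n :+ k :+ con 4 :+ con 2 :* (con 1 :+ c) :+ con 2 :* q :=
    ((con 1 :+ c) :* ((con 1 :+ c) :* con 1) :+ (con 1 :+ n) :+ k :+ con 2) :+ (con 2 :+ con 2 :* q)) refl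

exceeds : ∀ {t m e} → m ≡ t + e → 0 < e → ¬ (m ≤ t)
exceeds {t} refl lt le = ℕₚ.<⇒≱ (ℕₚ.m<m+n t lt) le

-- The right-hand side is twice the bound for a lollipop with cycle length `c`. For `a = c + 1 + e`
-- the target exceeds it by `(1 + e) * (2 * c + e)`, which is positive.
target-increasing : ∀ {a c k} → 1 ≤ c → c ≤ a → target a (a + k) k ≤ 2 + 2 * ((a + k) ∸ c) + c * suc c → a ≡ c
target-increasing {a} {c} {k} 1≤c c≤a le with a ∸ c in eq
... | zero  = ℕₚ.≤-antisym (ℕₚ.m∸n≡0⇒m≤n eq) c≤a
... | suc e = ⊥-elim (exceeds (difference c e k) (ℕₚ.<-≤-trans (s≤s z≤n) (ℕₚ.*-monoʳ-≤ (suc e) (ℕₚ.≤-trans (ℕₚ.*-monoʳ-≤ 2 1≤c) (ℕₚ.m≤m+n (2 * c) e))))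
    (subst₂ (λ x y → target x (x + k) k ≤ 2 + 2 * y + c * suc c) a≡ gap le))
  where
  a≡ : a ≡ c + suc e
  a≡ = trans (sym (ℕₚ.m+[n∸m]≡n c≤a)) (cong (c +_) eq)
  gap : (a + k) ∸ c ≡ suc e + k
  gap = trans (ℕₚ.+-∸-comm k c≤a) (cong (_+ k) eq)
  difference : ∀ c e k → target (c + suc e) (c + suc e + k) k ≡ (2 + 2 * (suc e + k) + c * suc c) + suc e * (2 * c + e)
  difference = solve 3 (λ c e k →
    (c :+ (con 1 :+ e)) :* ((c :+ (con 1 :+ e)) :* con 1) :+ (c :+ (con 1 :+ e) :+ k) :+ k :+ con 2 :=
    (con 2 :+ con 2 :* (con 1 :+ e :+ k) :+ c :* (con 1 :+ c)) :+ (con 1 :+ e) :* (con 2 :* c :+ e)) refl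

count-at-c : ∀ a k → 2 + 2 * ((a + k) ∸ a) + a * suc a ≡ target a (a + k) k
count-at-c a k = trans (cong (λ x → 2 + 2 * x + a * suc a) (ℕₚ.m+n∸m≡n a k)) (solve 2 (λ a k →
  con 2 :+ con 2 :* k :+ a :* (con 1 :+ a) := a :* (a :* con 1) :+ (a :+ k) :+ k :+ con 2) refl a k)

-- The bound and the case of equality

module Main {n k : ℕ} (1≤k : 1 ≤ k) (k+3≤n : k + 3 ≤ n) (G : Graph n) (sG : Symmetric G) (irr : ∀ i → ¬ T (G i i)) (conn : Connected G)
  (cutCount : NumCutVertices G k) (¬tree : ¬ IsTree G) (v : Fin n) {N : ℕ} (count : fCount G v N) where

  open CutVertices G cutCount

  abstract
    r-data : Σ[ r ∈ Fin n ] (Good G r × ¬ NonCut G r)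
    r-data = good-cut sG irr conn 1≤k ¬tree

  open Enumeration G sG irr conn v count (proj₁ r-data) (proj₁ (proj₂ r-data)) (proj₂ (proj₂ r-data))

  c : ℕ
  c = length nonCuts

  c+k≡n : c + k ≡ n
  c+k≡n = trans (cong (c +_) (sym length-cuts)) (trans (length-filter-¬ (nonCut? G) (allFin n)) (length-allFin n))

  n∸k≡c : n ∸ k ≡ c
  n∸k≡c = trans (cong (_∸ k) (sym c+k≡n)) (ℕₚ.m+n∸n≡m c k)

  3≤c : 3 ≤ c
  3≤c = ℕₚ.+-cancelʳ-≤ k 3 c (ℕₚ.≤-trans (ℕₚ.≤-reflexive (ℕₚ.+-comm 3 k)) (ℕₚ.≤-trans k+3≤n (ℕₚ.≤-reflexive (sym c+k≡n))))

  p+c₁≡c : length pendants + length inner ≡ c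
  p+c₁≡c = length-filter-¬ (pendant? G) nonCuts

  1+n′≡n : suc (length (without-v (allFin n))) ≡ n
  1+n′≡n = trans (length-without-∈ Finₚ._≟_ (Uniqueₚ.allFin⁺ n) (∈-allFin v)) (length-allFin n)

  Bound : ℕ → Set
  Bound ℓ = target c n k ≤ ℓ × (ℓ ≤ target c n k → Pendant G v × without-v pendants ≡ [])

  bound-strict : ∀ {ℓ e} → ℓ ≡ target c n k + e → 0 < e → Bound ℓ
  bound-strict eq lt = ℕₚ.≤-trans (ℕₚ.m≤m+n _ _) (ℕₚ.≤-reflexive (sym eq)) , λ le → ⊥-elim (exceeds eq lt le)

  bound-cut : ¬ NonCut G v → Bound (length objects)
  bound-cut cut = bound-strict (trans length-objects (trans
      (cong₂ (λ c′ q → enumerated c′ (length (without-v cuts)) (length (without-v (allFin n))) q (length inner))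
        (length-without-∉ Finₚ._≟_ (cut ∘ ∈-nonCuts)) (length-without-∉ Finₚ._≟_ v∉pendants))
      (trans (enumerated-cut c (length (without-v cuts)) (length (without-v (allFin n))) (length pendants) (length inner))
        (cong₂ (λ n k → target c n k + (2 * length inner + 4 * length pendants)) 1+n′≡n
          (trans (length-without-∈ Finₚ._≟_ unique-cuts (∈-filter⁺ (¬? ∘ nonCut? G) (∈-allFin v) cut)) length-cuts)))))
    -- The surplus is positive because the inner and the pendant vertices together are the `c ≥ 3`
    -- non-cut vertices.
    (ℕₚ.<-≤-trans (ℕₚ.<-≤-trans (s≤s z≤n) 3≤c) (ℕₚ.≤-trans (ℕₚ.≤-reflexive (trans (sym p+c₁≡c) (ℕₚ.+-comm (length pendants) (length inner))))
      (ℕₚ.+-mono-≤ (ℕₚ.m≤n*m (length inner) 2) (ℕₚ.m≤n*m (length pendants) 4))))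
    where
    v∉pendants : v ∉ pendants
    v∉pendants v∈ = cut (∈-nonCuts (proj₁ (∈-filter⁻ (pendant? G) {xs = nonCuts} v∈)))

  module _ (nc : NonCut G v) where

    v∈nonCuts : v ∈ nonCuts
    v∈nonCuts = ∈-filter⁺ (nonCut? G) (∈-allFin v) nc

    1+c′≡c : suc (length (without-v nonCuts)) ≡ c
    1+c′≡c = length-without-∈ Finₚ._≟_ unique-nonCuts v∈nonCuts

    k′≡k : length (without-v cuts) ≡ k
    k′≡k = trans (length-without-∉ Finₚ._≟_ (λ v∈ → ∈-cuts v∈ nc)) length-cuts

    bound-inner : ¬ Pendant G v → Bound (length objects)
    bound-inner ¬pend = bound-strict (trans length-objects (trans
        (enumerated-inner (length (without-v nonCuts)) (length (without-v cuts)) (length (without-v (allFin n))) (length (without-v pendants)) (length inner)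
          (trans 1+c′≡c (trans (sym p+c₁≡c) (cong (_+ length inner) (sym (length-without-∉ Finₚ._≟_ (¬pend ∘ ∈-pendants)))))))
        (cong (_+ (2 + 2 * length (without-v pendants))) (trans (cong₂ (λ c n → target c n (length (without-v cuts))) 1+c′≡c 1+n′≡n) (cong (target c n) k′≡k)))))
      (s≤s z≤n)

    bound-pendant : Pendant G v → Bound (length objects)
    bound-pendant pend = ℕₚ.≤-trans (ℕₚ.m≤m+n _ _) (ℕₚ.≤-reflexive (sym len)) , λ le → pend , none le
      where
      q = length (without-v pendants)
      c₁ = length inner
      1+q≡p : suc q ≡ length pendants
      1+q≡p = length-without-∈ Finₚ._≟_ unique-pendants (∈-filter⁺ (pendant? G) v∈nonCuts pend)
      c≡ : suc (q + c₁) ≡ c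
      c≡ = trans (cong (_+ c₁) 1+q≡p) p+c₁≡c
      len : length objects ≡ target c n k + 2 * q
      len = trans length-objects (trans
        (cong₂ (λ c′ k → enumerated c′ k (length (without-v (allFin n))) q c₁) (ℕₚ.suc-injective (trans 1+c′≡c (sym c≡))) k′≡k)
        (trans (enumerated-pendant k (length (without-v (allFin n))) q c₁) (cong₂ (λ c n → target c n k + 2 * q) c≡ 1+n′≡n)))
      none : length objects ≤ target c n k → without-v pendants ≡ []
      none le = empty (without-v pendants) λ lt → exceeds len (ℕₚ.≤-trans lt (ℕₚ.m≤m+n _ _)) le
        where
        empty : ∀ (xs : List (Fin n)) → ¬ (0 < length xs) → xs ≡ []
        empty []      _ = refl
        empty (_ ∷ _) h = ⊥-elim (h (s≤s z≤n))

  bound : Bound (length objects)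
  bound with nonCut? G v
  ... | no cut = bound-cut cut
  ... | yes nc with pendant? G v
  ...   | yes pend = bound-pendant nc pend
  ...   | no ¬pend = bound-inner nc ¬pend

  lower : target c n k ≤ 2 * N
  lower = ℕₚ.≤-trans (proj₁ bound) (ℕₚ.≤-trans length-objects≤ (ℕₚ.≤-reflexive (ℕₚ.*-comm N 2)))

  PendantIso : ℕ → Set
  PendantIso c = Σ (Fin n ↔ Fin n) (λ σ → Iso G (L n c) σ × (toℕ (Inverse.to σ v) ≡ n ∸ 1))

  attained : PendantIso c → 2 * N ≡ target c n k
  attained (σ , iso , σv) = ℕₚ.≤-antisym
    (ℕₚ.≤-trans (lollipop-count≤ G v c σ (ℕₚ.≤-trans (s≤s z≤n) 3≤c) iso σv count)
      (ℕₚ.≤-reflexive (subst (λ n → 2 + 2 * (n ∸ c) + c * suc c ≡ target c n k) c+k≡n (count-at-c c k))))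
    lower

  module _ (eq : 2 * N ≡ target c n k) where

    N*2≡ : N * 2 ≡ target c n k
    N*2≡ = trans (ℕₚ.*-comm N 2) eq

    tight : Pendant G v × without-v pendants ≡ []
    tight = proj₂ bound (ℕₚ.≤-trans length-objects≤ (ℕₚ.≤-reflexive N*2≡))

    only-v : ∀ {x} → Pendant G x → x ≡ v
    only-v {x} pend = decidable-stable (x Finₚ.≟ v) λ x≢v → case subst (x ∈_) (proj₂ tight)
      (∈-filter⁺ (λ x → ¬? (x Finₚ.≟ v)) (∈-filter⁺ (pendant? G) (∈-filter⁺ (nonCut? G) (∈-allFin x) (pendant⇒nonCut sG conn pend)) pend) x≢v) of λ ()

    r≢v : proj₁ r-data ≢ v
    r≢v r≡v = good⇒¬pendant sG irr conn (proj₁ (proj₂ r-data)) (subst (Pendant G) (sym r≡v) (proj₁ tight))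

    open Extremal G sG irr conn v (classify (ℕₚ.≤-trans (ℕₚ.≤-reflexive N*2≡) (proj₁ bound)) (proj₂ tight))
      (proj₁ tight) only-v (proj₁ r-data) r≢v

    cycleLength≤c : cycleLength ≤ c
    cycleLength≤c = let (zs , u , len , nc) = cycle-nonCuts in
      subst (_≤ c) len (unique-⊆⇒length≤ u λ z∈ → ∈-filter⁺ (nonCut? G) (∈-allFin _) (nc z∈))

    -- The traversal shows only that the cycle has at most `c` vertices. A shorter cycle would leave
    -- too few connected subgraphs to reach the target.
    c≡cycleLength : c ≡ cycleLength
    c≡cycleLength = target-increasing (s≤s z≤n) cycleLength≤c
      (subst (λ n → target c n k ≤ 2 + 2 * (n ∸ cycleLength) + cycleLength * suc cycleLength) (sym c+k≡n)
        (subst (_≤ 2 + 2 * (n ∸ cycleLength) + cycleLength * suc cycleLength) eq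
          (lollipop-count≤ G v cycleLength σ (s≤s z≤n) iso σ-v count)))

    extremal : PendantIso c
    extremal = subst PendantIso (sym c≡cycleLength) (σ , iso , σ-v)

theorem3p16 : (n k : ℕ) → 1 ≤ k → k + 3 ≤ n →
    (G : Graph n) → IsSimple G → Connected G → NumCutVertices G k → ¬ IsTree G →
    (v : Fin n) → (N : ℕ) → fCount G v N →
    ((n ∸ k) ^ 2 + n + k + 2 ≤ 2 * N) ×
    ((2 * N ≡ (n ∸ k) ^ 2 + n + k + 2) ⇔
    Σ (Fin n ↔ Fin n) (λ σ → Iso G (L n (n ∸ k)) σ × (toℕ (Inverse.to σ v) ≡ n ∸ 1)))
theorem3p16 n k 1≤k k+3≤n G (sG , irr) conn cutCount ¬tree v N count =
  subst (λ c → target c n k ≤ 2 * N × (2 * N ≡ target c n k ⇔ PendantIso c)) (sym n∸k≡c) (lower , mk⇔ extremal attained)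
  where
  open Main 1≤k k+3≤n G sG irr conn cutCount ¬tree v count
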